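{- For every $n\geq 1$, let $M_e(n)$ be the number of (distinct, not necessarily inequivalent) even self-dual $L$-codes of length $n$. Then $$M_e(n)=\sum_{[C]}\frac{2^n\cdot n!}{|\mathrm{Aut}(C)|}=\prod_{i=0}^{n-1}(2^i+1),$$ where the sum runs over the equivalence classes $[C]$ of even self-dual $L$-codes of length $n$.
   Context: Let $L=\{0,1,\omega,\bar\omega\}$ be the Klein four-group $\mathbf{Z}_2\times\mathbf{Z}_2$. Define $|0|^2=0$, $|1|^2=1$, $|\omega|^2=|\bar\omega|^2=2$ and $q(x)=|x|^2 \bmod 2$. The dot product on $L$ is $x\cdot y=q(x+y)-q(x)-q(y)\in\mathbf{F}_2$; explicitly $x\cdot y=1$ iff $x,y$ are distinct and both nonzero. On $L^n$ the scalar product is $(\mathbf{x},\mathbf{y})=\sum_i x_i\cdot y_i$ and the Euclidean weight is $\mathrm{ewt}(\mathbf{x})=\sum_i|x_i|^2$. An $L$-code of length $n$ is a subgroup $C\subseteq L^n$; $C^\perp=\{\mathbf{x}:(\mathbf{x},\mathbf{y})=0\ \forall\mathbf{y}\in C\}$; $C$ is self-dual if $C=C^\perp$ and even if $\mathrm{ewt}(\mathbf{x})$ is even for every $\mathbf{x}\in C$. The group $G=S_2^n{:}S_n$ (order $2^n n!$) acts on $L^n$ by permuting coordinates and independently interchanging $\omega,\bar\omega$ in each coordinate; codes in the same $G$-orbit are equivalent, and $\mathrm{Aut}(C)=\{g\in G:gC=C\}$. -}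

module Defs where

open import Data.Bool using (Bool; true; false; _xor_; not)
open import Data.Nat using (ℕ; zero; suc; _+_; _*_; _^_)
open import Data.Nat.DivMod using (_/_)
open import Data.Nat.Divisibility using (_∣_; _∣?_)
open import Data.Fin using (Fin; combine)
open import Data.Fin.Properties using (all?)
import Data.Fin.Properties as FinP
open import Data.Vec using (Vec; []; _∷_; lookup; replicate; zipWith)
open import Data.List using (List; []; _∷_; length; filter; concatMap; map; allFin)
open import Data.Product using (_×_; _,_; Σ; proj₁; proj₂)
open import Relation.Nullary using (Dec; yes; no; ¬_)
open import Relation.Nullary.Decidable using (map′; _×-dec_; _→-dec_)
open import Relation.Unary using (Decidable)
open import Relation.Binary.PropositionalEquality using (_≡_; refl)
open import Data.Bool.Properties using () renaming (_≟_ to _≟ᵇ_)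

data L : Set where
  𝟘 𝟙 ω ω̄ : L

_⊕_ : L → L → L
𝟘 ⊕ y = y
x ⊕ 𝟘 = x
𝟙 ⊕ 𝟙 = 𝟘
𝟙 ⊕ ω = ω̄
𝟙 ⊕ ω̄ = ω
ω ⊕ 𝟙 = ω̄
ω ⊕ ω = 𝟘
ω ⊕ ω̄ = 𝟙
ω̄ ⊕ 𝟙 = ω
ω̄ ⊕ ω = 𝟙
ω̄ ⊕ ω̄ = 𝟘

norm : L → ℕ
norm 𝟘 = 0
norm 𝟙 = 1
norm ω = 2
norm ω̄ = 2

-- q(x) = |x|^2 mod 2, as an element of F2 = Bool (false = 0, true = 1)
q : L → Bool
q 𝟘 = false
q 𝟙 = true
q ω = false
q ω̄ = false

-- x · y = q(x+y) - q(x) - q(y) in F2 (subtraction = addition = xor)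
_·_ : L → L → Bool
x · y = (q (x ⊕ y) xor q x) xor q y

Word : ℕ → Set
Word n = Vec L n

0ʷ : ∀ {n} → Word n
0ʷ = replicate _ 𝟘

_+ʷ_ : ∀ {n} → Word n → Word n → Word n
_+ʷ_ = zipWith _⊕_

⟨_,_⟩ : ∀ {n} → Word n → Word n → Bool
⟨ [] , [] ⟩ = false
⟨ x ∷ xs , y ∷ ys ⟩ = (x · y) xor ⟨ xs , ys ⟩

ewt : ∀ {n} → Word n → ℕ
ewt [] = 0
ewt (x ∷ xs) = norm x + ewt xs

-- Subsets of L^n.  A subset is its characteristic vector indexed by
-- Fin (4 ^ n), via the (bijective) base-4 encoding of words below.
-- Distinct subsets are thus exactly distinct vectors.

codeL : L → Fin 4
codeL 𝟘 = Fin.zero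
codeL 𝟙 = Fin.suc Fin.zero
codeL ω = Fin.suc (Fin.suc Fin.zero)
codeL ω̄ = Fin.suc (Fin.suc (Fin.suc Fin.zero))

encode : ∀ {n} → Word n → Fin (4 ^ n)
encode [] = Fin.zero
encode (x ∷ xs) = combine (codeL x) (encode xs)

record SubsetL (n : ℕ) : Set where
  constructor mkSubset
  field
    bits : Vec Bool (4 ^ n)
open SubsetL public

_∈ᶜ_ : ∀ {n} → Word n → SubsetL n → Set
x ∈ᶜ C = lookup (bits C) (encode x) ≡ true

-- C is an L-code: a subgroup of L^n (contains 0, closed under +;
-- inverses are automatic since every element has order ≤ 2)
IsCode : ∀ {n} → SubsetL n → Set
IsCode {n} C = (0ʷ ∈ᶜ C) × (∀ (x y : Word n) → x ∈ᶜ C → y ∈ᶜ C → (x +ʷ y) ∈ᶜ C)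

_∈⊥_ : ∀ {n} → Word n → SubsetL n → Set
_∈⊥_ {n} x C = ∀ (y : Word n) → y ∈ᶜ C → ⟨ x , y ⟩ ≡ false

IsSelfDual : ∀ {n} → SubsetL n → Set
IsSelfDual {n} C = ∀ (x : Word n) → (x ∈ᶜ C → x ∈⊥ C) × (x ∈⊥ C → x ∈ᶜ C)

IsEven : ∀ {n} → SubsetL n → Set
IsEven {n} C = ∀ (x : Word n) → x ∈ᶜ C → 2 ∣ ewt x

IsEvenSelfDualCode : ∀ {n} → SubsetL n → Set
IsEvenSelfDualCode C = IsCode C × IsSelfDual C × IsEven C

allL? : {P : L → Set} → Decidable P → Dec (∀ x → P x)
allL? {P} d with d 𝟘 | d 𝟙 | d ω | d ω̄
... | yes a | yes b | yes c | yes e = yes λ { 𝟘 → a ; 𝟙 → b ; ω → c ; ω̄ → e }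
... | no ¬a | _ | _ | _ = no λ f → ¬a (f 𝟘)
... | yes _ | no ¬b | _ | _ = no λ f → ¬b (f 𝟙)
... | yes _ | yes _ | no ¬c | _ = no λ f → ¬c (f ω)
... | yes _ | yes _ | yes _ | no ¬e = no λ f → ¬e (f ω̄)

allW? : ∀ {n} {P : Word n → Set} → Decidable P → Dec (∀ x → P x)
allW? {zero} {P} d = map′ (λ { p [] → p }) (λ f → f []) (d [])
allW? {suc n} {P} d =
  map′ (λ f → λ { (x ∷ xs) → f x xs }) (λ f x xs → f (x ∷ xs))
       (allL? (λ x → allW? {n} {λ xs → P (x ∷ xs)} (λ xs → d (x ∷ xs))))

∈ᶜ? : ∀ {n} (x : Word n) (C : SubsetL n) → Dec (x ∈ᶜ C)
∈ᶜ? x C = lookup (bits C) (encode x) ≟ᵇ true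

∈⊥? : ∀ {n} (x : Word n) (C : SubsetL n) → Dec (x ∈⊥ C)
∈⊥? x C = allW? (λ y → ∈ᶜ? y C →-dec (⟨ x , y ⟩ ≟ᵇ false))

isEvenSelfDualCode? : ∀ {n} → Decidable (IsEvenSelfDualCode {n})
isEvenSelfDualCode? C =
  (∈ᶜ? 0ʷ C ×-dec allW? (λ x → allW? (λ y → ∈ᶜ? x C →-dec (∈ᶜ? y C →-dec ∈ᶜ? (x +ʷ y) C))))
  ×-dec (allW? (λ x → (∈ᶜ? x C →-dec ∈⊥? x C) ×-dec (∈⊥? x C →-dec ∈ᶜ? x C)))
  ×-dec allW? (λ x → ∈ᶜ? x C →-dec (2 ∣? ewt x))

allVecs : ∀ {a} {A : Set a} → List A → (m : ℕ) → List (Vec A m)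
allVecs xs zero = [] ∷ []
allVecs xs (suc m) = concatMap (λ x → map (x ∷_) (allVecs xs m)) xs

allSubsets : (n : ℕ) → List (SubsetL n)
allSubsets n = map mkSubset (allVecs (true ∷ false ∷ []) (4 ^ n))

Mₑ : ℕ → ℕ
Mₑ n = length (filter isEvenSelfDualCode? (allSubsets n))

-- σ : Fin n → Fin n given by its table, required to be injective (hence a permutation)
IsPerm : ∀ {n} → Vec (Fin n) n → Set
IsPerm {n} σ = ∀ (i j : Fin n) → lookup σ i ≡ lookup σ j → i ≡ j

isPerm? : ∀ {n} → Decidable (IsPerm {n})
isPerm? σ = all? (λ i → all? (λ j → (lookup σ i FinP.≟ lookup σ j) →-dec (i FinP.≟ j)))

-- an element of G: a permutation table together with a flip pattern
GElt : ℕ → Set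
GElt n = Vec (Fin n) n × Vec Bool n

IsG : ∀ {n} → GElt n → Set
IsG g = IsPerm (proj₁ g)

flip : Bool → L → L
flip true ω = ω̄
flip true ω̄ = ω
flip _ x = x

act : ∀ {n} → GElt n → Word n → Word n
act {n} (σ , b) x = Data.Vec.tabulate (λ i → flip (lookup b i) (lookup x (lookup σ i)))

-- g D = C (as sets); since x ↦ g x is a bijection of L^n this is
-- ∀ x, x ∈ D ↔ g x ∈ C
MapsTo : ∀ {n} → GElt n → SubsetL n → SubsetL n → Set
MapsTo {n} g D C = ∀ (x : Word n) → (x ∈ᶜ D → act g x ∈ᶜ C) × (act g x ∈ᶜ C → x ∈ᶜ D)

mapsTo? : ∀ {n} (g : GElt n) (D C : SubsetL n) → Dec (MapsTo g D C)
mapsTo? g D C = allW? (λ x → (∈ᶜ? x D →-dec ∈ᶜ? (act g x) C) ×-dec (∈ᶜ? (act g x) C →-dec ∈ᶜ? x D))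

allG : (n : ℕ) → List (GElt n)
allG n = concatMap (λ σ → map (σ ,_) (allVecs (true ∷ false ∷ []) n))
                   (filter isPerm? (allVecs (allFin n) n))

autOrder : ∀ {n} → SubsetL n → ℕ
autOrder {n} C = length (filter (λ g → mapsTo? g C C) (allG n))

Equivalent : ∀ {n} → SubsetL n → SubsetL n → Set
Equivalent {n} C D = Σ (GElt n) (λ g → IsG g × MapsTo g C D)

-- natural-number division, total (denominator 0 never occurs here,
-- since |Aut(C)| ≥ 1)
_÷_ : ℕ → ℕ → ℕ
a ÷ zero = 0
a ÷ suc b = a / suc b

prodTerm : ℕ → ℕ
prodTerm zero = 1
prodTerm (suc n) = prodTerm n * (2 ^ n + 1)

{-# OPTIONS --safe #-}

-- Reduction along the isotropic word e = (ω, 0, …, 0) sends an even self-dual code C of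
-- length n + 1 to C′ = {x : (0, x) ∈ C or (ω, x) ∈ C}, even self-dual of length n.  One C
-- over C′ contains e; the others are determined by the coset u + C′ of the u with
-- (t, u) ∈ C for some t with t · ω = 1 (t being fixed by evenness), and all 2ⁿ cosets occur.
-- So 2ⁿ + 1 codes lie over each C′, which gives the product.  The mass formula is
-- orbit–stabiliser for G acting on the even self-dual codes, summed over the orbits.
module Submission where

open import Defs
open import Data.Nat using (ℕ; _≤_; _*_; _^_; _!)
open import Data.List using (List; map)
open import Data.Nat.ListAction using (sum)
open import Data.List.Relation.Unary.All using (All)
open import Data.List.Relation.Unary.Any using (Any)
open import Data.List.Relation.Unary.AllPairs using (AllPairs)
open import Data.Product using (_×_)
open import Relation.Nullary using (¬_)
open import Relation.Binary.PropositionalEquality using (_≡_)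

open import Data.Bool using (Bool; true; false; _xor_; _∧_; not; if_then_else_)
open import Data.Bool.Properties using (not-involutive; xor-same; xor-comm; xor-assoc; xor-identityʳ; ∧-zeroʳ)
  renaming (_≟_ to _≟ᵇ_)
open import Data.Bool.Solver using (module xor-∧-Solver)
open import Data.Fin using (Fin; combine; remQuot; punchIn; punchOut) renaming (zero to fz; suc to fs)
open import Data.Fin.Permutation using (Permutation′; permutation)
open import Data.Fin.Properties
  using (remQuot-combine; combine-remQuot; any?; suc-injective; injective⇒≤;
         punchIn-injective; punchInᵢ≢i; punchIn-punchOut; punchOut-injective)
  renaming (_≟_ to _≟ᶠ_)
open import Data.List using ([]; _∷_; length; filter; concatMap; _++_; allFin; cartesianProduct; cartesianProductWith)
open import Data.List.Membership.Propositional using (_∈_; find; lose)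
open import Data.List.Membership.Propositional.Properties
  using (∈-allFin; ∈-cartesianProduct⁺; ∈-cartesianProductWith⁺; ∈-cartesianProductWith⁻;
         ∈-filter⁺; ∈-filter⁻; ∈-map⁺; ∈-map⁻)
open import Data.List.Membership.Propositional.Properties.WithK using (unique∧set⇒bag)
open import Data.List.Properties
  using (length-++; length-map; length-tabulate; filter-accept; filter-reject; map-cong-local)
open import Data.List.Relation.Binary.BagAndSetEquality using (∼bag⇒↭)
open import Data.List.Relation.Binary.Permutation.Propositional.Properties using (↭-length)
open import Data.List.Relation.Unary.All as All using ([]; _∷_)
import Data.List.Relation.Unary.All.Properties as All
open import Data.List.Relation.Unary.AllPairs as AllPairs using ([]; _∷_)
open import Data.List.Relation.Unary.Any as Any using (here; there)
open import Data.List.Relation.Unary.Unique.Propositional using (Unique)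
import Data.List.Relation.Unary.Unique.Propositional.Properties as Unique
open import Data.Maybe using (Maybe; just; nothing)
open import Data.Maybe.Properties using (just-injective)
open import Data.Nat using (zero; suc; _+_)
open import Data.Nat.Divisibility using (_∣_; divides)
open import Data.Nat.DivMod using (m*n/n≡m)
open import Data.Nat.Properties using (+-comm; +-suc; *-comm; *-suc; *-zeroʳ; 1+n≰n; +-0-commutativeMonoid)
open import Algebra.Properties.CommutativeMonoid.Sum +-0-commutativeMonoid
  using (sum-permute; sum-cong-≗) renaming (sum to ∑)
open import Data.Product using (_,_; ∃; proj₁; proj₂; Σ-syntax)
open import Data.Sum using (_⊎_; inj₁; inj₂)
open import Data.Unit using (⊤; tt)
open import Data.Vec as Vec using (Vec; []; _∷_; lookup; tabulate; replicate; zipWith)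
open import Data.Vec.Properties
  using (∷-injective; ∷-injectiveˡ; ∷-injectiveʳ; ≡-dec; lookup∘tabulate; tabulate∘lookup; tabulate-cong;
         lookup-map; lookup-zipWith; lookup-replicate)
open import Function using (_∘_; mk⇔)
open import Relation.Binary.PropositionalEquality
  using (_≢_; refl; sym; trans; cong; cong₂; subst; module ≡-Reasoning)
open import Relation.Nullary using (Dec; yes; no; does; contradiction)
open import Relation.Nullary.Decidable using (map′; dec-true; from-yes; _×-dec_; _⊎-dec_; _→-dec_)
open import Relation.Unary using (Decidable)

-- The delicate point is to name the cosets u + C′ canonically, since u is known only up to C′. The
-- syndrome map does this: it is additive from Lⁿ to F₂ⁿ, its kernel is C′, and `coset` is an
-- explicit section of it, so syndromes label the 2ⁿ cosets without the order of C′ being computed.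
-- Syndromes in length n + 1 are built from those in length n; a code thus becomes a sequence of
-- choices, and the count a bijection between two lists without repetitions. The word e is suitable
-- because q(ω) = 0 and only 0 and ω are orthogonal to ω in L. On this line q and the dot product
-- vanish, so dropping a first coordinate that lies on it changes neither parities of weights nor
-- scalar products. The two elements off the line, 1 and ω̄, have different values of q, which is
-- why evenness leaves a single t for each u.

private variable
  A B D : Set
  n : ℕ

-- Counting with finite lists

unique-same-length : {xs ys : List A} → Unique xs → Unique ys →
  (∀ {x} → x ∈ xs → x ∈ ys) → (∀ {x} → x ∈ ys → x ∈ xs) → length xs ≡ length ys
unique-same-length uxs uys to from = ↭-length (∼bag⇒↭ (unique∧set⇒bag uxs uys (mk⇔ to from)))

concatMap-map : (f : A → B → D) (xs : List A) (ys : List B) →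
  concatMap (λ x → map (f x) ys) xs ≡ cartesianProductWith f xs ys
concatMap-map f []       ys = refl
concatMap-map f (x ∷ xs) ys = cong (map (f x) ys ++_) (concatMap-map f xs ys)

length-cartesianProductWith : (f : A → B → D) (xs : List A) (ys : List B) →
  length (cartesianProductWith f xs ys) ≡ length xs * length ys
length-cartesianProductWith f []       ys = refl
length-cartesianProductWith f (x ∷ xs) ys = trans (length-++ (map (f x) ys))
  (cong₂ _+_ (length-map (f x) ys) (length-cartesianProductWith f xs ys))

allVecs-suc : (xs : List A) (m : ℕ) → allVecs xs (suc m) ≡ cartesianProductWith _∷_ xs (allVecs xs m)
allVecs-suc xs m = concatMap-map _∷_ xs (allVecs xs m)

∈-allVecs : {xs : List A} → (∀ x → x ∈ xs) → ∀ {m} (v : Vec A m) → v ∈ allVecs xs m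
∈-allVecs all [] = here refl
∈-allVecs {xs = xs} all {suc m} (x ∷ v) = subst (x ∷ v ∈_) (sym (allVecs-suc xs m))
  (∈-cartesianProductWith⁺ _∷_ (all x) (∈-allVecs all v))

allVecs-unique : {xs : List A} → Unique xs → ∀ m → Unique (allVecs xs m)
allVecs-unique u zero = [] ∷ []
allVecs-unique {xs = xs} u (suc m) = subst Unique (sym (allVecs-suc xs m))
  (Unique.cartesianProductWith⁺ _∷_ ∷-injective u (allVecs-unique u m))

length-allVecs : (xs : List A) (m : ℕ) → length (allVecs xs m) ≡ length xs ^ m
length-allVecs xs zero    = refl
length-allVecs xs (suc m) = trans (cong length (allVecs-suc xs m))
  (trans (length-cartesianProductWith _∷_ xs (allVecs xs m)) (cong (length xs *_) (length-allVecs xs m)))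

module _ {R : A → B → Set} (R? : ∀ x y → Dec (R x y)) where

  fibre : List A → B → List A
  fibre xs y = filter (λ x → R? x y) xs

  fibreSum : List A → List B → ℕ
  fibreSum xs ys = sum (map (λ y → length (fibre xs y)) ys)

  private
    fibreSum-[] : ∀ ys → fibreSum [] ys ≡ 0
    fibreSum-[] []       = refl
    fibreSum-[] (y ∷ ys) = fibreSum-[] ys

    fibreSum-unrelated : ∀ {x} xs {ys} → All (λ y → ¬ R x y) ys → fibreSum (x ∷ xs) ys ≡ fibreSum xs ys
    fibreSum-unrelated xs [] = refl
    fibreSum-unrelated xs {y ∷ _} (¬r ∷ ¬rs) =
      cong₂ _+_ (cong length (filter-reject (λ x → R? x y) ¬r)) (fibreSum-unrelated xs ¬rs)

    fibreSum-related : ∀ {x} xs {ys} → AllPairs (λ y y′ → R x y → ¬ R x y′) ys → Any (R x) ys →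
      fibreSum (x ∷ xs) ys ≡ suc (fibreSum xs ys)
    fibreSum-related xs {y ∷ _} (ap ∷ _) (here r) =
      cong₂ _+_ (cong length (filter-accept (λ x → R? x y) r))
                (fibreSum-unrelated xs (All.map (λ f → f r) ap))
    fibreSum-related {x} xs {y ∷ ys} (ap ∷ aps) (there rs) =
      trans (cong₂ _+_ (cong length (filter-reject (λ x → R? x y) ¬r)) (fibreSum-related xs aps rs))
            (+-suc _ _)
      where
      ¬r : ¬ R x y
      ¬r r with All.lookupAny ap rs
      ... | f , r′ = f r r′

  -- Double counting: `cover` puts each x into at least one fibre and disjointness into at most one.
  -- Disjointness is asked only for x in `xs`, because a table g determines the code g D once it is
  -- known to lie in G. Applied to G fibred over the codes g D, and to the codes fibred over the
  -- representatives.
  length-fibres : ∀ xs ys → (∀ {x} → x ∈ xs → Any (R x) ys) →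
    AllPairs (λ y y′ → ∀ x → x ∈ xs → R x y → ¬ R x y′) ys → length xs ≡ fibreSum xs ys
  length-fibres []       ys cover disj = sym (fibreSum-[] ys)
  length-fibres (x ∷ xs) ys cover disj = trans
    (cong suc (length-fibres xs ys (cover ∘ there) (AllPairs.map (λ d x′ x′∈ → d x′ (there x′∈)) disj)))
    (sym (fibreSum-related xs (AllPairs.map (λ d → d x (here refl)) disj) (cover (here refl))))

sum-filter : {P : A → Set} (P? : Decidable P) (f : A → ℕ) (k : ℕ) →
  (∀ x → P x → f x ≡ k) → (∀ x → ¬ P x → f x ≡ 0) →
  ∀ xs → sum (map f xs) ≡ k * length (filter P? xs)
sum-filter P? f k on off [] = sym (*-zeroʳ k)
sum-filter P? f k on off (x ∷ xs) with P? x | sum-filter P? f k on off xs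
... | yes p | ih = trans (cong₂ _+_ (on x p) ih) (sym (*-suc k _))
... | no ¬p | ih = cong₂ _+_ (off x ¬p) ih

lookup-ext : ∀ {n} {u v : Vec A n} → (∀ i → lookup u i ≡ lookup v i) → u ≡ v
lookup-ext {u = u} {v} eq = trans (sym (tabulate∘lookup u)) (trans (tabulate-cong eq) (tabulate∘lookup v))

bools : List Bool
bools = true ∷ false ∷ []

∈-bools : ∀ b → b ∈ bools
∈-bools true  = here refl
∈-bools false = there (here refl)

bools-unique : Unique bools
bools-unique = ((λ ()) ∷ []) ∷ [] ∷ []

-- Subsets of Lⁿ

decodeL : Fin 4 → L
decodeL fz                = 𝟘
decodeL (fs fz)           = 𝟙
decodeL (fs (fs fz))      = ω
decodeL (fs (fs (fs fz))) = ω̄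

decodeL-codeL : ∀ a → decodeL (codeL a) ≡ a
decodeL-codeL 𝟘 = refl
decodeL-codeL 𝟙 = refl
decodeL-codeL ω = refl
decodeL-codeL ω̄ = refl

codeL-decodeL : ∀ i → codeL (decodeL i) ≡ i
codeL-decodeL fz                = refl
codeL-decodeL (fs fz)           = refl
codeL-decodeL (fs (fs fz))      = refl
codeL-decodeL (fs (fs (fs fz))) = refl

decode : ∀ {n} → Fin (4 ^ n) → Word n
decode {zero}  i = []
decode {suc n} i = decodeL (proj₁ (remQuot {4} (4 ^ n) i)) ∷ decode (proj₂ (remQuot {4} (4 ^ n) i))

decode-encode : ∀ {n} (x : Word n) → decode (encode x) ≡ x
decode-encode [] = refl
decode-encode (a ∷ x) = trans
  (cong (λ p → decodeL (proj₁ p) ∷ decode (proj₂ p)) (remQuot-combine (codeL a) (encode x)))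
  (cong₂ _∷_ (decodeL-codeL a) (decode-encode x))

encode-decode : ∀ {n} (i : Fin (4 ^ n)) → encode {n} (decode i) ≡ i
encode-decode {zero}  fz = refl
encode-decode {suc n} i  = trans
  (cong₂ combine (codeL-decodeL (proj₁ (remQuot {4} (4 ^ n) i))) (encode-decode {n} (proj₂ (remQuot {4} (4 ^ n) i))))
  (combine-remQuot {4} (4 ^ n) i)

anyW? : ∀ {n} {P : Word n → Set} → Decidable P → Dec (∃ P)
anyW? {P = P} P? = map′ (λ (i , p) → decode i , p)
  (λ (x , p) → encode x , subst P (sym (decode-encode x)) p) (any? (P? ∘ decode))

_≐_ : ∀ {n} → (Word n → Set) → (Word n → Set) → Set
P ≐ Q = ∀ x → (P x → Q x) × (Q x → P x)

module _ {n} {P : Word n → Set} (P? : Decidable P) where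

  subsetOf : SubsetL n
  subsetOf = mkSubset (tabulate (λ i → does (P? (decode i))))

  private
    lookup-subsetOf : ∀ x → lookup (bits subsetOf) (encode x) ≡ does (P? x)
    lookup-subsetOf x = trans (lookup∘tabulate _ (encode x)) (cong (does ∘ P?) (decode-encode x))

  subsetOf-≐ : (_∈ᶜ subsetOf) ≐ P
  subsetOf-≐ x = to (P? x) refl , λ p → trans (lookup-subsetOf x) (dec-true (P? x) p)
    where
    to : (d : Dec (P x)) → does (P? x) ≡ does d → x ∈ᶜ subsetOf → P x
    to (yes p) _  _  = p
    to (no _)  eq x∈ with () ← trans (sym x∈) (trans (lookup-subsetOf x) eq)

-- Every index is the encoding of some word, so equal membership forces equal bits.
subset-ext : ∀ {n} {C D : SubsetL n} → (_∈ᶜ C) ≐ (_∈ᶜ D) → C ≡ D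
subset-ext {n} {C} {D} C≐D = cong mkSubset (lookup-ext λ i →
  subst (λ j → lookup (bits C) j ≡ lookup (bits D) j) (encode-decode {n} i)
    (bool-ext (proj₁ (C≐D (decode i))) (proj₂ (C≐D (decode i)))))
  where
  bool-ext : ∀ {a b} → (a ≡ true → b ≡ true) → (b ≡ true → a ≡ true) → a ≡ b
  bool-ext {true}  {b}     f g = sym (f refl)
  bool-ext {false} {true}  f g = g refl
  bool-ext {false} {false} f g = refl

∈-allSubsets : ∀ {n} (C : SubsetL n) → C ∈ allSubsets n
∈-allSubsets (mkSubset v) = ∈-map⁺ mkSubset (∈-allVecs ∈-bools v)

allSubsets-unique : ∀ n → Unique (allSubsets n)
allSubsets-unique n = Unique.map⁺ (cong bits) (allVecs-unique bools-unique (4 ^ n))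

evenSelfDualCodes : ∀ n → List (SubsetL n)
evenSelfDualCodes n = filter isEvenSelfDualCode? (allSubsets n)

_≟ᴸ_ : (a b : L) → Dec (a ≡ b)
a ≟ᴸ b = map′ (λ e → trans (sym (decodeL-codeL a)) (trans (cong decodeL e) (decodeL-codeL b)))
  (cong codeL) (codeL a ≟ᶠ codeL b)

allB? : {P : Bool → Set} → Decidable P → Dec (∀ b → P b)
allB? d = map′ (λ { (f , t) false → f ; (f , t) true → t }) (λ f → f false , f true) (d false ×-dec d true)

-- The quadratic space Lⁿ

⊕-comm : ∀ a b → a ⊕ b ≡ b ⊕ a
⊕-comm = from-yes (allL? λ a → allL? λ b → (a ⊕ b) ≟ᴸ (b ⊕ a))

⊕-cancel : ∀ a b → (a ⊕ b) ⊕ b ≡ a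
⊕-cancel = from-yes (allL? λ a → allL? λ b → ((a ⊕ b) ⊕ b) ≟ᴸ a)

·-comm : ∀ a b → a · b ≡ b · a
·-comm = from-yes (allL? λ a → allL? λ b → (a · b) ≟ᵇ (b · a))

·-⊕ˡ : ∀ a b c → (a ⊕ b) · c ≡ (a · c) xor (b · c)
·-⊕ˡ = from-yes (allL? λ a → allL? λ b → allL? λ c → ((a ⊕ b) · c) ≟ᵇ ((a · c) xor (b · c)))

q-⊕ : ∀ a b → q (a ⊕ b) ≡ (a · b) xor (q a xor q b)
q-⊕ = from-yes (allL? λ a → allL? λ b → q (a ⊕ b) ≟ᵇ ((a · b) xor (q a xor q b)))

infix 30 ω^_
ω^_ : Bool → L
ω^ b = if b then ω else 𝟘

-- the element t with t · ω = 1 and q t = b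
pivot : Bool → L
pivot b = if b then 𝟙 else ω̄

pivot-ω : ∀ b → pivot b · ω ≡ true
pivot-ω = from-yes (allB? λ b → (pivot b · ω) ≟ᵇ true)

-- The elements off the line {0, ω} are 1 and ω̄, and q tells them apart.
pivot-unique : ∀ a → a · ω ≡ true → a ≡ pivot (q a)
pivot-unique = from-yes (allL? λ a → ((a · ω) ≟ᵇ true) →-dec (a ≟ᴸ pivot (q a)))

ω^-·ω : ∀ b → ω^ b · ω ≡ false
ω^-·ω = from-yes (allB? λ b → (ω^ b · ω) ≟ᵇ false)

·-ω^ : ∀ a b → a · ω^ b ≡ (a · ω) ∧ b
·-ω^ = from-yes (allL? λ a → allB? λ b → (a · ω^ b) ≟ᵇ ((a · ω) ∧ b))

ω^-·pivot : ∀ b c → ω^ b · pivot c ≡ b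
ω^-·pivot = from-yes (allB? λ b → allB? λ c → (ω^ b · pivot c) ≟ᵇ b)

-- ω and any element off its line form a basis of L, and the dot product is nondegenerate.
·ω-pivot-injective : ∀ a a′ b → a · ω ≡ a′ · ω → a · pivot b ≡ a′ · pivot b → a ≡ a′
·ω-pivot-injective = from-yes (allL? λ a → allL? λ a′ → allB? λ b →
  ((a · ω) ≟ᵇ (a′ · ω)) →-dec (((a · pivot b) ≟ᵇ (a′ · pivot b)) →-dec (a ≟ᴸ a′)))

isotropic-line : ∀ a b → a · ω ≡ false → b · ω ≡ false → a · b ≡ false
isotropic-line = from-yes (allL? λ a → allL? λ b →
  ((a · ω) ≟ᵇ false) →-dec (((b · ω) ≟ᵇ false) →-dec ((a · b) ≟ᵇ false)))

q-line : ∀ a → a · ω ≡ false → q a ≡ false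
q-line = from-yes (allL? λ a → ((a · ω) ≟ᵇ false) →-dec (q a ≟ᵇ false))

line : ∀ a → a · ω ≡ false → (a ≡ 𝟘) ⊎ (a ≡ ω)
line 𝟘 _ = inj₁ refl
line ω _ = inj₂ refl

-- On the line both sides vanish. Off it, a and `pivot b` are orthogonal only if equal, so a ·
-- `pivot b` = q(a) + b and the two copies of b cancel. The free b is later set to the parity of the
-- coset representative.
q-by-pivot : ∀ a b → q a ≡ ((a · ω) ∧ b) xor ((a · ω) ∧ (a · pivot b))
q-by-pivot = from-yes (allL? λ a → allB? λ b → q a ≟ᵇ (((a · ω) ∧ b) xor ((a · ω) ∧ (a · pivot b))))

xor-≡false : ∀ a b → a xor b ≡ false → a ≡ b
xor-≡false = from-yes (allB? λ a → allB? λ b → ((a xor b) ≟ᵇ false) →-dec (a ≟ᵇ b))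

xor-cancel : ∀ b c → (b xor c) xor c ≡ b
xor-cancel = from-yes (allB? λ b → allB? λ c → ((b xor c) xor c) ≟ᵇ b)

-- the quadratic form x ↦ ewt x mod 2
qʷ : Word n → Bool
qʷ []      = false
qʷ (a ∷ x) = q a xor qʷ x

infix 30 _•_
_•_ : Bool → Word n → Word n
b • x = if b then x else 0ʷ

open xor-∧-Solver using (solve; _:+_; _:*_; _:=_)

+ʷ-comm : (x y : Word n) → x +ʷ y ≡ y +ʷ x
+ʷ-comm []      []      = refl
+ʷ-comm (a ∷ x) (b ∷ y) = cong₂ _∷_ (⊕-comm a b) (+ʷ-comm x y)

+ʷ-cancel : (x y : Word n) → (x +ʷ y) +ʷ y ≡ x
+ʷ-cancel []      []      = refl
+ʷ-cancel (a ∷ x) (b ∷ y) = cong₂ _∷_ (⊕-cancel a b) (+ʷ-cancel x y)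

+ʷ-identityʳ : (x : Word n) → x +ʷ 0ʷ ≡ x
+ʷ-identityʳ []      = refl
+ʷ-identityʳ (a ∷ x) = cong₂ _∷_ (⊕-comm a 𝟘) (+ʷ-identityʳ x)

⟨⟩-comm : (x y : Word n) → ⟨ x , y ⟩ ≡ ⟨ y , x ⟩
⟨⟩-comm []      []      = refl
⟨⟩-comm (a ∷ x) (b ∷ y) = cong₂ _xor_ (·-comm a b) (⟨⟩-comm x y)

⟨⟩-+ˡ : (x y z : Word n) → ⟨ x +ʷ y , z ⟩ ≡ ⟨ x , z ⟩ xor ⟨ y , z ⟩
⟨⟩-+ˡ []      []      []      = refl
⟨⟩-+ˡ (a ∷ x) (b ∷ y) (c ∷ z) = trans (cong₂ _xor_ (·-⊕ˡ a b c) (⟨⟩-+ˡ x y z))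
  (solve 4 (λ p r s t → (p :+ r) :+ (s :+ t) := (p :+ s) :+ (r :+ t)) refl (a · c) (b · c) ⟨ x , z ⟩ ⟨ y , z ⟩)

⟨⟩-+ʳ : (z x y : Word n) → ⟨ z , x +ʷ y ⟩ ≡ ⟨ z , x ⟩ xor ⟨ z , y ⟩
⟨⟩-+ʳ z x y = trans (⟨⟩-comm z (x +ʷ y)) (trans (⟨⟩-+ˡ x y z) (cong₂ _xor_ (⟨⟩-comm x z) (⟨⟩-comm y z)))

⟨0,⟩ : (x : Word n) → ⟨ 0ʷ , x ⟩ ≡ false
⟨0,⟩ []      = refl
⟨0,⟩ (𝟘 ∷ x) = ⟨0,⟩ x
⟨0,⟩ (𝟙 ∷ x) = ⟨0,⟩ x
⟨0,⟩ (ω ∷ x) = ⟨0,⟩ x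
⟨0,⟩ (ω̄ ∷ x) = ⟨0,⟩ x

⟨•,⟩ : ∀ b (x y : Word n) → ⟨ b • x , y ⟩ ≡ b ∧ ⟨ x , y ⟩
⟨•,⟩ true  x y = refl
⟨•,⟩ false x y = ⟨0,⟩ y

⟨⟩-self : (x : Word n) → ⟨ x , x ⟩ ≡ false
⟨⟩-self []      = refl
⟨⟩-self (a ∷ x) = trans (cong (_xor ⟨ x , x ⟩) (self a)) (⟨⟩-self x)
  where
  self : ∀ a → a · a ≡ false
  self = from-yes (allL? λ a → (a · a) ≟ᵇ false)

qʷ-0 : ∀ n → qʷ (0ʷ {n}) ≡ false
qʷ-0 zero    = refl
qʷ-0 (suc n) = qʷ-0 n

qʷ-• : ∀ b (x : Word n) → qʷ (b • x) ≡ b ∧ qʷ x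
qʷ-• true  x = refl
qʷ-• {n} false x = qʷ-0 n

qʷ-+ : (x y : Word n) → qʷ (x +ʷ y) ≡ ⟨ x , y ⟩ xor (qʷ x xor qʷ y)
qʷ-+ []      []      = refl
qʷ-+ (a ∷ x) (b ∷ y) = trans (cong₂ _xor_ (q-⊕ a b) (qʷ-+ x y))
  (solve 6 (λ p r s t u v → (p :+ (r :+ s)) :+ (t :+ (u :+ v)) := (p :+ t) :+ ((r :+ u) :+ (s :+ v)))
    refl (a · b) (q a) (q b) ⟨ x , y ⟩ (qʷ x) (qʷ y))

odd : ℕ → Bool
odd zero    = false
odd (suc m) = not (odd m)

odd⇒2∣ : ∀ m → odd m ≡ false → 2 ∣ m
odd⇒2∣ zero          _ = divides 0 refl
odd⇒2∣ (suc (suc m)) e with odd⇒2∣ m (trans (sym (not-involutive (odd m))) e)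
... | divides k refl = divides (suc k) refl

2∣⇒odd : ∀ {m} → 2 ∣ m → odd m ≡ false
2∣⇒odd (divides k refl) = go k
  where
  go : ∀ k → odd (k * 2) ≡ false
  go zero    = refl
  go (suc k) = trans (not-involutive _) (go k)

odd-ewt : (x : Word n) → odd (ewt x) ≡ qʷ x
odd-ewt []      = refl
odd-ewt (𝟘 ∷ x) = odd-ewt x
odd-ewt (𝟙 ∷ x) = cong not (odd-ewt x)
odd-ewt (ω ∷ x) = trans (not-involutive _) (odd-ewt x)
odd-ewt (ω̄ ∷ x) = trans (not-involutive _) (odd-ewt x)

even⇒qʷ : ∀ (x : Word n) → 2 ∣ ewt x → qʷ x ≡ false
even⇒qʷ x = trans (sym (odd-ewt x)) ∘ 2∣⇒odd

qʷ⇒even : ∀ (x : Word n) → qʷ x ≡ false → 2 ∣ ewt x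
qʷ⇒even x e = odd⇒2∣ (ewt x) (trans (odd-ewt x) e)

-- Parametrisation of the even self-dual codes

-- If c describes C′, then (c , nothing) describes {0, ω} × C′, and (c , just s) the code
-- generated by (t, u) and the words (ω⟨u,y⟩, y), y ∈ C′, where u represents the coset of
-- C′ of syndrome s.  The syndrome of a word consists of its scalar products with a basis
-- of the code, so the code is the kernel of the syndrome map.
Code : ℕ → Set
Code zero    = ⊤
Code (suc n) = Code n × Maybe (Vec Bool n)

-- A chosen representative of each coset of the code, defined so that its syndrome is the given
-- vector.
coset : Code n → Vec Bool n → Word n
coset {zero}  _            []      = []
coset {suc n} (c , nothing) (b ∷ s) = (if b then 𝟙 else 𝟘) ∷ coset c s
-- A head on the line {0, ω} leaves the tail unshifted in `syndrome`. Its product with the head of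
-- the glue word is its own coefficient, so adding the product of the tails in advance makes the
-- first syndrome entry b.
coset {suc n} (c , just r)  (b ∷ s) = ω^ (b xor ⟨ coset c s , coset c r ⟩) ∷ coset c s

-- The generator (t, u); the head is the element off the line that makes the total weight even.
glue : Code n → Vec Bool n → Word (suc n)
glue c s = pivot (qʷ (coset c s)) ∷ coset c s

syndrome : Code n → Word n → Vec Bool n
syndrome {zero}  _             []      = []
syndrome {suc n} (c , nothing) (a ∷ x) = (a · ω) ∷ syndrome c x
-- If a is off the line, adding the glue word brings the head back to the line, and the new tail x +
-- u must lie in C′. Dually, for y in C′ the product of x + (a · ω)u with y is that of (a, x) with
-- the lifted word (ω⟨u,y⟩, y).
syndrome {suc n} (c , just s)  (a ∷ x) =
  ⟨ a ∷ x , glue c s ⟩ ∷ syndrome c (x +ʷ ((a · ω) • coset c s))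

0ᵇ : Vec Bool n
0ᵇ = replicate _ false

_⊞_ : Vec Bool n → Vec Bool n → Vec Bool n
_⊞_ = zipWith _xor_

Ker : Code n → Word n → Set
Ker c x = syndrome c x ≡ 0ᵇ

+ʷ-self : (x : Word n) → x +ʷ x ≡ 0ʷ
+ʷ-self []      = refl
+ʷ-self (a ∷ x) = cong₂ _∷_ (self a) (+ʷ-self x)
  where
  self : ∀ a → a ⊕ a ≡ 𝟘
  self = from-yes (allL? λ a → (a ⊕ a) ≟ᴸ 𝟘)

+ʷ-interchange : (x y z w : Word n) → (x +ʷ y) +ʷ (z +ʷ w) ≡ (x +ʷ z) +ʷ (y +ʷ w)
+ʷ-interchange []      []      []      []      = refl
+ʷ-interchange (a ∷ x) (b ∷ y) (c ∷ z) (d ∷ w) = cong₂ _∷_ (interchange a b c d) (+ʷ-interchange x y z w)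
  where
  interchange : ∀ a b c d → (a ⊕ b) ⊕ (c ⊕ d) ≡ (a ⊕ c) ⊕ (b ⊕ d)
  interchange = from-yes (allL? λ a → allL? λ b → allL? λ c → allL? λ d →
    ((a ⊕ b) ⊕ (c ⊕ d)) ≟ᴸ ((a ⊕ c) ⊕ (b ⊕ d)))

•-xor : ∀ b c (x : Word n) → (b xor c) • x ≡ (b • x) +ʷ (c • x)
•-xor false c     x = sym (trans (+ʷ-comm 0ʷ (c • x)) (+ʷ-identityʳ (c • x)))
•-xor true  false x = sym (+ʷ-identityʳ x)
•-xor true  true  x = sym (+ʷ-self x)

⊞-self : (s : Vec Bool n) → s ⊞ s ≡ 0ᵇ
⊞-self []      = refl
⊞-self (b ∷ s) = cong₂ _∷_ (xor-same b) (⊞-self s)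

⊞≡0⇒≡ : (s r : Vec Bool n) → s ⊞ r ≡ 0ᵇ → s ≡ r
⊞≡0⇒≡ []      []      _  = refl
⊞≡0⇒≡ (b ∷ s) (c ∷ r) eq = cong₂ _∷_ (xor-≡false b c (∷-injectiveˡ eq)) (⊞≡0⇒≡ s r (∷-injectiveʳ eq))

syndrome-+ : (c : Code n) (x y : Word n) → syndrome c (x +ʷ y) ≡ syndrome c x ⊞ syndrome c y
syndrome-+ {zero}  _             []      []      = refl
syndrome-+ {suc n} (c , nothing) (a ∷ x) (b ∷ y) = cong₂ _∷_ (·-⊕ˡ a b ω) (syndrome-+ c x y)
syndrome-+ {suc n} (c , just s)  (a ∷ x) (b ∷ y) = cong₂ _∷_
  (⟨⟩-+ˡ (a ∷ x) (b ∷ y) (glue c s))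
  (trans (cong (syndrome c) eq) (syndrome-+ c _ _))
  where
  u = coset c s
  eq : (x +ʷ y) +ʷ (((a ⊕ b) · ω) • u) ≡ (x +ʷ ((a · ω) • u)) +ʷ (y +ʷ ((b · ω) • u))
  eq = trans (cong ((x +ʷ y) +ʷ_) (trans (cong (_• u) (·-⊕ˡ a b ω)) (•-xor (a · ω) (b · ω) u)))
             (+ʷ-interchange x y _ _)

syndrome-0 : (c : Code n) → syndrome c 0ʷ ≡ 0ᵇ
syndrome-0 c = trans (cong (syndrome c) (sym (+ʷ-self 0ʷ))) (trans (syndrome-+ c 0ʷ 0ʷ) (⊞-self _))

-- Makes the syndrome map onto, so all 2ⁿ labels name cosets, and distinct labels distinct ones.
syndrome-coset : (c : Code n) (s : Vec Bool n) → syndrome c (coset c s) ≡ s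
syndrome-coset {zero}  _             []      = refl
syndrome-coset {suc n} (c , nothing) (b ∷ s) = cong₂ _∷_ (head b) (syndrome-coset c s)
  where
  head : ∀ b → (if b then 𝟙 else 𝟘) · ω ≡ b
  head = from-yes (allB? λ b → ((if b then 𝟙 else 𝟘) · ω) ≟ᵇ b)
syndrome-coset {suc n} (c , just r) (b ∷ s) = cong₂ _∷_
  (trans (cong (_xor ⟨ v , u ⟩) (ω^-·pivot (b xor ⟨ v , u ⟩) (qʷ u))) (xor-cancel b ⟨ v , u ⟩))
  (trans (cong (λ β → syndrome c (v +ʷ β • u)) (ω^-·ω (b xor ⟨ v , u ⟩)))
         (trans (cong (syndrome c) (+ʷ-identityʳ v)) (syndrome-coset c s)))
  where
  u = coset c r
  v = coset c s

Ker-+ : (c : Code n) (x y : Word n) → Ker c x → Ker c y → Ker c (x +ʷ y)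
Ker-+ c x y kx ky = trans (syndrome-+ c x y) (trans (cong₂ _⊞_ kx ky) (⊞-self _))

-- In the glued case the induction hypothesis concerns x + βu with β = a · ω. The vanishing first
-- entry of the syndrome replaces the product of a with the pivot by ⟨x,u⟩; by `q-by-pivot` the
-- weight parity of (a, x) is then exactly the expansion of that of x + βu.
Ker-qʷ : (c : Code n) (x : Word n) → Ker c x → qʷ x ≡ false
Ker-qʷ {zero}  _             []      _ = refl
Ker-qʷ {suc n} (c , nothing) (a ∷ x) k =
  cong₂ _xor_ (q-line a (∷-injectiveˡ k)) (Ker-qʷ c x (∷-injectiveʳ k))
Ker-qʷ {suc n} (c , just s) (a ∷ x) k = begin
  q a xor qʷ x
    ≡⟨ cong (_xor qʷ x) (q-by-pivot a (qʷ u)) ⟩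
  ((β ∧ qʷ u) xor (β ∧ (a · pivot (qʷ u)))) xor qʷ x
    ≡⟨ cong (λ z → ((β ∧ qʷ u) xor (β ∧ z)) xor qʷ x) (xor-≡false _ _ (∷-injectiveˡ k)) ⟩
  ((β ∧ qʷ u) xor (β ∧ ⟨ x , u ⟩)) xor qʷ x
    ≡⟨ solve 4 (λ b p r s → (b :* p :+ b :* r) :+ s := b :* r :+ (s :+ b :* p)) refl β (qʷ u) ⟨ x , u ⟩ (qʷ x) ⟩
  (β ∧ ⟨ x , u ⟩) xor (qʷ x xor (β ∧ qʷ u))
    ≡⟨ cong (λ z → (β ∧ z) xor (qʷ x xor (β ∧ qʷ u))) (⟨⟩-comm x u) ⟩
  (β ∧ ⟨ u , x ⟩) xor (qʷ x xor (β ∧ qʷ u))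
    ≡⟨ cong₂ (λ z w → z xor (qʷ x xor w)) (trans (⟨⟩-comm x (β • u)) (⟨•,⟩ β u x)) (qʷ-• β u) ⟨
  ⟨ x , β • u ⟩ xor (qʷ x xor qʷ (β • u))
    ≡⟨ qʷ-+ x (β • u) ⟨
  qʷ (x +ʷ β • u)
    ≡⟨ Ker-qʷ c _ (∷-injectiveʳ k) ⟩
  false ∎
  where
  open ≡-Reasoning
  u = coset c s
  β = a · ω

polarisation : (x y : Word n) → qʷ x ≡ false → qʷ y ≡ false → qʷ (x +ʷ y) ≡ false → ⟨ x , y ⟩ ≡ false
polarisation x y qx qy qxy = trans (sym (xor-identityʳ _))
  (trans (cong (⟨ x , y ⟩ xor_) (sym (cong₂ _xor_ qx qy))) (trans (sym (qʷ-+ x y)) qxy))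

-- The scalar product is the polar form of `qʷ`, which vanishes on the whole subgroup.
Ker-⟨⟩ : (c : Code n) (x y : Word n) → Ker c x → Ker c y → ⟨ x , y ⟩ ≡ false
Ker-⟨⟩ c x y kx ky = polarisation x y (Ker-qʷ c x kx) (Ker-qʷ c y ky) (Ker-qʷ c (x +ʷ y) (Ker-+ c x y kx ky))

Ker-axis : (c : Code n) → Ker (c , nothing) (ω ∷ 0ʷ)
Ker-axis c = cong (false ∷_) (syndrome-0 c)

Ker-glue : (c : Code n) (s : Vec Bool n) → Ker (c , just s) (glue c s)
Ker-glue c s = cong₂ _∷_ (⟨⟩-self (glue c s))
  (trans (cong (λ β → syndrome c (u +ʷ β • u)) (pivot-ω (qʷ u)))
         (trans (cong (syndrome c) (+ʷ-self u)) (syndrome-0 c)))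
  where u = coset c s

shift-line : ∀ a (x u : Word n) → a · ω ≡ false → x +ʷ ((a · ω) • u) ≡ x
shift-line a x u h = trans (cong (λ β → x +ʷ β • u) h) (+ʷ-identityʳ x)

-- The head is the multiple of ω that cancels the product of y with the tail of the glue word.
Ker-lift : (c : Code n) (s : Vec Bool n) (y : Word n) → Ker c y → Ker (c , just s) (ω^ ⟨ coset c s , y ⟩ ∷ y)
Ker-lift c s y ky = cong₂ _∷_
  (trans (cong₂ _xor_ (ω^-·pivot ⟨ u , y ⟩ (qʷ u)) (⟨⟩-comm y u)) (xor-same ⟨ u , y ⟩))
  (trans (cong (syndrome c) (shift-line (ω^ ⟨ u , y ⟩) y u (ω^-·ω ⟨ u , y ⟩))) ky)
  where u = coset c s

-- It suffices to test x against generators: the axis word or the glue word yields the first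
-- syndrome entry, and the words lifted from C′ yield the induction hypothesis for the remaining
-- ones.
Ker-⊥ : (c : Code n) (x : Word n) → (∀ y → Ker c y → ⟨ x , y ⟩ ≡ false) → Ker c x
Ker-⊥ {zero}  _             []      _  = refl
Ker-⊥ {suc n} (c , nothing) (a ∷ x) x⊥ = cong₂ _∷_
  (trans (sym (trans (cong (a · ω xor_) (trans (⟨⟩-comm x 0ʷ) (⟨0,⟩ x))) (xor-identityʳ _)))
         (x⊥ (ω ∷ 0ʷ) (Ker-axis c)))
  (Ker-⊥ c x λ y ky → trans (cong (_xor ⟨ x , y ⟩) (sym (·𝟘 a))) (x⊥ (𝟘 ∷ y) (cong (false ∷_) ky)))
  where
  ·𝟘 : ∀ a → a · 𝟘 ≡ false
  ·𝟘 = from-yes (allL? λ a → (a · 𝟘) ≟ᵇ false)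
Ker-⊥ {suc n} (c , just s) (a ∷ x) x⊥ = cong₂ _∷_
  (x⊥ (glue c s) (Ker-glue c s))
  (Ker-⊥ c _ λ y ky → begin
    ⟨ x +ʷ (a · ω) • u , y ⟩          ≡⟨ ⟨⟩-+ˡ x _ y ⟩
    ⟨ x , y ⟩ xor ⟨ (a · ω) • u , y ⟩ ≡⟨ cong (⟨ x , y ⟩ xor_) (⟨•,⟩ (a · ω) u y) ⟩
    ⟨ x , y ⟩ xor ((a · ω) ∧ ⟨ u , y ⟩) ≡⟨ cong (⟨ x , y ⟩ xor_) (sym (·-ω^ a ⟨ u , y ⟩)) ⟩
    ⟨ x , y ⟩ xor (a · ω^ ⟨ u , y ⟩)  ≡⟨ xor-comm ⟨ x , y ⟩ _ ⟩
    ⟨ a ∷ x , ω^ ⟨ u , y ⟩ ∷ y ⟩      ≡⟨ x⊥ _ (Ker-lift c s y ky) ⟩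
    false ∎)
  where
  open ≡-Reasoning
  u = coset c s

-- The reduction C′. Writing a ∈ {0, ω} as orthogonality to ω lets closure under addition follow
-- from bilinearity.
Reduces : (Word (suc n) → Set) → Word n → Set
Reduces P x = Σ[ a ∈ L ] (a · ω ≡ false × P (a ∷ x))

Ker-reduces : (c : Code n) (m : Maybe (Vec Bool n)) (x : Word n) → Ker c x → Reduces (Ker (c , m)) x
Ker-reduces c nothing  x kx = 𝟘 , refl , cong (false ∷_) kx
Ker-reduces c (just s) x kx = ω^ ⟨ coset c s , x ⟩ , ω^-·ω ⟨ coset c s , x ⟩ , Ker-lift c s x kx

reduces-Ker : (c : Code n) (m : Maybe (Vec Bool n)) (x : Word n) → Reduces (Ker (c , m)) x → Ker c x
reduces-Ker c nothing  x (a , h , k) = ∷-injectiveʳ k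
reduces-Ker c (just s) x (a , h , k) =
  trans (cong (syndrome c) (sym (shift-line a x (coset c s) h))) (∷-injectiveʳ k)

axis∉Ker : (c : Code n) (s : Vec Bool n) → ¬ Ker (c , just s) (ω ∷ 0ʷ)
axis∉Ker c s k = contradiction (trans (sym axis-glue) (∷-injectiveˡ k)) λ ()
  where
  b = qʷ (coset c s)
  axis-glue : ⟨ ω ∷ 0ʷ , glue c s ⟩ ≡ true
  axis-glue = cong₂ _xor_ (trans (·-comm ω (pivot b)) (pivot-ω b)) (⟨0,⟩ (coset c s))

-- The reduction of a kernel is the kernel of its first component, so induction identifies these.
-- Membership of e then separates `nothing` from `just`, and the glue words separate different
-- syndromes.
Ker-injective : (c d : Code n) → (∀ x → Ker c x → Ker d x) → (∀ x → Ker d x → Ker c x) → c ≡ d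
Ker-injective {zero}  _       _       _ _ = refl
Ker-injective {suc n} (c , m) (d , p) c⊆d d⊆c
  with refl ← Ker-injective c d
    (λ x kx → let a , h , k = Ker-reduces c m x kx in reduces-Ker d p x (a , h , c⊆d _ k))
    (λ x kx → let a , h , k = Ker-reduces d p x kx in reduces-Ker c m x (a , h , d⊆c _ k))
  = cong (c ,_) (last m p c⊆d d⊆c)
  where
  last : ∀ m p → (∀ x → Ker (c , m) x → Ker (c , p) x) → (∀ x → Ker (c , p) x → Ker (c , m) x) → m ≡ p
  last nothing  nothing  _ _ = refl
  last nothing  (just s) f g = contradiction (f (ω ∷ 0ʷ) (Ker-axis c)) (axis∉Ker c s)
  last (just s) nothing  f g = contradiction (g (ω ∷ 0ʷ) (Ker-axis c)) (axis∉Ker c s)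
  last (just s) (just r) f g = cong just (begin
    s                                          ≡⟨ syndrome-coset c s ⟨
    syndrome c u                               ≡⟨ ⊞≡0⇒≡ _ _ (trans (sym (syndrome-+ c u v)) u+v∈) ⟩
    syndrome c v                               ≡⟨ syndrome-coset c r ⟩
    r                                          ∎)
    where
    open ≡-Reasoning
    u = coset c s
    v = coset c r
    -- The glue word for s lies in the code for r, and its head is off the line, so its tail u is
    -- tested after the shift by v.
    u+v∈ : Ker c (u +ʷ v)
    u+v∈ = trans (cong (λ β → syndrome c (u +ʷ β • v)) (sym (pivot-ω (qʷ u))))
                 (∷-injectiveʳ (f (glue c s) (Ker-glue c s)))

-- Every even self-dual code is a kernel

reduces? : {P : Word (suc n) → Set} → Decidable P → Decidable (Reduces P)
reduces? {P = P} P? x = map′ (λ { (inj₁ p) → 𝟘 , refl , p ; (inj₂ p) → ω , refl , p }) from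
  (P? (𝟘 ∷ x) ⊎-dec P? (ω ∷ x))
  where
  from : Reduces P x → P (𝟘 ∷ x) ⊎ P (ω ∷ x)
  from (a , h , p) with line a h
  ... | inj₁ refl = inj₁ p
  ... | inj₂ refl = inj₂ p

·ω-⊕ : ∀ a b {c d} → a · ω ≡ c → b · ω ≡ d → (a ⊕ b) · ω ≡ c xor d
·ω-⊕ a b ha hb = trans (·-⊕ˡ a b ω) (cong₂ _xor_ ha hb)

-- Stated for predicates, so that it applies alike to subsets, kernels, reductions and preimages
-- under G, with parity expressed by the quadratic form.
record EvenSelfDual (P : Word n → Set) : Set where
  field
    zero∈      : P 0ʷ
    closed     : ∀ {x y} → P x → P y → P (x +ʷ y)
    orthogonal : ∀ {x y} → P x → P y → ⟨ x , y ⟩ ≡ false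
    maximal    : ∀ {x} → (∀ y → P y → ⟨ x , y ⟩ ≡ false) → P x
    isotropic  : ∀ {x} → P x → qʷ x ≡ false

esd⇒EvenSelfDual : (C : SubsetL n) → IsEvenSelfDualCode C → EvenSelfDual (_∈ᶜ C)
esd⇒EvenSelfDual C ((z , cl) , sd , ev) = record
  { zero∈      = z
  ; closed     = λ {x} {y} → cl x y
  ; orthogonal = λ {x} {y} x∈ → proj₁ (sd x) x∈ y
  ; maximal    = λ {x} → proj₂ (sd x)
  ; isotropic  = λ {x} x∈ → even⇒qʷ x (ev x x∈)
  }

EvenSelfDual⇒esd : {P : Word n → Set} → EvenSelfDual P → (C : SubsetL n) → (_∈ᶜ C) ≐ P → IsEvenSelfDualCode C
EvenSelfDual⇒esd esd C C≐ =
  ( proj₂ (C≐ 0ʷ) zero∈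
  , λ x y x∈ y∈ → proj₂ (C≐ (x +ʷ y)) (closed (proj₁ (C≐ x) x∈) (proj₁ (C≐ y) y∈)))
  , (λ x → (λ x∈ y y∈ → orthogonal (proj₁ (C≐ x) x∈) (proj₁ (C≐ y) y∈))
         , (λ x⊥ → proj₂ (C≐ x) (maximal λ y y∈ → x⊥ y (proj₂ (C≐ y) y∈))))
  , (λ x x∈ → qʷ⇒even x (isotropic (proj₁ (C≐ x) x∈)))
  where open EvenSelfDual esd

Ker-esd : (c : Code n) → EvenSelfDual (Ker c)
Ker-esd c = record
  { zero∈      = syndrome-0 c
  ; closed     = λ {x} {y} → Ker-+ c x y
  ; orthogonal = λ {x} {y} → Ker-⟨⟩ c x y
  ; maximal    = λ {x} → Ker-⊥ c x
  ; isotropic  = λ {x} → Ker-qʷ c x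
  }

module Reduction {n} (P : Word (suc n) → Set) (P? : Decidable P) (esd : EvenSelfDual P) where

  open EvenSelfDual esd

  Red : Word n → Set
  Red = Reduces P

  -- The words of the code not orthogonal to e; by self-duality one exists exactly when e is outside
  -- the code.
  Transversal : Word (suc n) → Set
  Transversal (t ∷ u) = t · ω ≡ true × P (t ∷ u)

  transversal? : Dec (∃ Transversal)
  transversal? = anyW? λ { (t ∷ u) → ((t · ω) ≟ᵇ true) ×-dec P? (t ∷ u) }

  Red-+ : ∀ {x y} → Red x → Red y → Red (x +ʷ y)
  Red-+ (a , ha , x∈) (b , hb , y∈) = a ⊕ b , ·ω-⊕ a b ha hb , closed x∈ y∈

  Red-⟨⟩ : ∀ {x y} → Red x → Red y → ⟨ x , y ⟩ ≡ false
  Red-⟨⟩ {x} {y} (a , ha , x∈) (b , hb , y∈) =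
    trans (cong (_xor ⟨ x , y ⟩) (sym (isotropic-line a b ha hb))) (orthogonal x∈ y∈)

  Red-qʷ : ∀ {x} → Red x → qʷ x ≡ false
  Red-qʷ {x} (a , ha , x∈) = trans (cong (_xor qʷ x) (sym (q-line a ha))) (isotropic x∈)

  Red-⊥ : ∀ {x} → (∀ y → Red y → ⟨ x , y ⟩ ≡ false) → Red x
  Red-⊥ {x} x⊥ with transversal?
  -- Here every word of the code has its head on the line, so prefixing 0 to x keeps it orthogonal
  -- to the code.
  ... | no ¬t = 𝟘 , refl , maximal λ { (b ∷ y) y∈ → cong₂ _xor_ (𝟘· b) (x⊥ y (b , on-line b y∈ , y∈)) }
    where
    𝟘· : ∀ b → 𝟘 · b ≡ false
    𝟘· b = trans (·-comm 𝟘 b) (trans (·-ω^ b false) (∧-zeroʳ (b · ω)))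
    on-line : ∀ b {y} → P (b ∷ y) → b · ω ≡ false
    on-line b {y} y∈ with (b · ω) in eq
    ... | false = refl
    ... | true  = contradiction ((b ∷ y) , eq , y∈) ¬t
  -- The head is chosen to make the word orthogonal to (t, u). Any other word with head off the line
  -- differs from (t, u) by one with head on the line, whose tail is covered by `x⊥`.
  ... | yes ((t ∷ u) , tω , t∈) = ω^ ⟨ x , u ⟩ , ω^-·ω ⟨ x , u ⟩ , maximal orth
    where
    orth : ∀ z → P z → ⟨ ω^ ⟨ x , u ⟩ ∷ x , z ⟩ ≡ false
    orth (b ∷ y) y∈ with (b · ω) in eq
    ... | false = cong₂ _xor_ (isotropic-line (ω^ ⟨ x , u ⟩) b (ω^-·ω ⟨ x , u ⟩) eq) (x⊥ y (b , eq , y∈))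
    ... | true  = begin
      (ω^ ⟨ x , u ⟩ · b) xor ⟨ x , y ⟩ ≡⟨ cong (_xor ⟨ x , y ⟩) (trans (·-comm (ω^ ⟨ x , u ⟩) b) (·-ω^ b ⟨ x , u ⟩)) ⟩
      ((b · ω) ∧ ⟨ x , u ⟩) xor ⟨ x , y ⟩ ≡⟨ cong (λ β → (β ∧ ⟨ x , u ⟩) xor ⟨ x , y ⟩) eq ⟩
      ⟨ x , u ⟩ xor ⟨ x , y ⟩         ≡⟨ xor-comm ⟨ x , u ⟩ ⟨ x , y ⟩ ⟩
      ⟨ x , y ⟩ xor ⟨ x , u ⟩         ≡⟨ sym (⟨⟩-+ʳ x y u) ⟩
      ⟨ x , y +ʷ u ⟩                  ≡⟨ x⊥ (y +ʷ u) (b ⊕ t , ·ω-⊕ b t eq tω , closed y∈ t∈) ⟩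
      false                           ∎
      where open ≡-Reasoning

  reduction-esd : EvenSelfDual Red
  reduction-esd = record
    { zero∈ = 𝟘 , refl , zero∈ ; closed = Red-+ ; orthogonal = Red-⟨⟩ ; maximal = Red-⊥ ; isotropic = Red-qʷ }

  -- Duality reverses inclusions, so one self-dual code inside another equals it.
  Ker⊆⇒≐ : (d : Code (suc n)) → (∀ x → Ker d x → P x) → P ≐ Ker d
  Ker⊆⇒≐ d Ker⊆ x = (λ x∈ → Ker-⊥ d x λ y ky → orthogonal x∈ (Ker⊆ y ky)) , Ker⊆ x

  module _ (c : Code n) (Ker⇒Red : ∀ x → Ker c x → Red x) where

    extend-axis : P (ω ∷ 0ʷ) → P ≐ Ker (c , nothing)
    extend-axis e∈ = Ker⊆⇒≐ (c , nothing) λ { (a ∷ x) k →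
      let b , hb , x∈ = Ker⇒Red x (∷-injectiveʳ k)
      in move a b x (line a (∷-injectiveˡ k)) (line b hb) x∈ }
      where
      add-axis : ∀ a x → P (a ∷ x) → P ((a ⊕ ω) ∷ x)
      add-axis a x x∈ = subst (λ y → P ((a ⊕ ω) ∷ y)) (+ʷ-identityʳ x) (closed x∈ e∈)
      move : ∀ a b x → a ≡ 𝟘 ⊎ a ≡ ω → b ≡ 𝟘 ⊎ b ≡ ω → P (b ∷ x) → P (a ∷ x)
      move _ _ x (inj₁ refl) (inj₁ refl) x∈ = x∈
      move _ _ x (inj₂ refl) (inj₂ refl) x∈ = x∈
      move _ _ x (inj₁ refl) (inj₂ refl) x∈ = add-axis ω x x∈
      move _ _ x (inj₂ refl) (inj₁ refl) x∈ = add-axis 𝟘 x x∈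

    extend-glue : ∀ t u → t · ω ≡ true → P (t ∷ u) → P ≐ Ker (c , just (syndrome c u))
    extend-glue t u tω t∈ = Ker⊆⇒≐ (c , just s) λ { (a ∷ x) k → member a x k }
      where
      s = syndrome c u
      v = coset c s
      p = pivot (qʷ v)

      v+u∈Ker : Ker c (v +ʷ u)
      v+u∈Ker = trans (syndrome-+ c v u) (trans (cong (_⊞ s) (syndrome-coset c s)) (⊞-self s))

      -- The transversal word found has tail u, not the chosen representative v of its coset. Adding
      -- a word of the code over v + u changes the tail to v; the head stays off the line, and
      -- isotropy forces it to be the pivot.
      glue∈ : P (glue c s)
      glue∈ with Ker⇒Red (v +ʷ u) v+u∈Ker
      ... | z , hz , z∈ = subst (λ a → P (a ∷ v)) is-pivot zt∈
        where
        zt∈ : P ((z ⊕ t) ∷ v)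
        zt∈ = subst (λ w → P ((z ⊕ t) ∷ w)) (+ʷ-cancel v u) (closed z∈ t∈)
        is-pivot : z ⊕ t ≡ p
        is-pivot = trans (pivot-unique (z ⊕ t) (·ω-⊕ z t hz tω))
                         (cong pivot (xor-≡false _ _ (isotropic zt∈)))

      -- (a, x) and some (a′, x) ∈ C agree on ω and, C being self-orthogonal, on the pivot.
      member : ∀ a x → Ker (c , just s) (a ∷ x) → P (a ∷ x)
      member a x k = let a′ , h , x∈ = same-line in
        subst (λ b → P (b ∷ x))
          (·ω-pivot-injective a′ a (qʷ v) h
            (trans (xor-≡false _ _ (orthogonal x∈ glue∈)) (sym (xor-≡false _ _ (∷-injectiveˡ k)))))
          x∈
        where
        same-line : Σ[ a′ ∈ L ] (a′ · ω ≡ a · ω × P (a′ ∷ x))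
        same-line with (a · ω) | Ker⇒Red _ (∷-injectiveʳ k)
        ... | false | z , hz , z∈ = z , hz , subst (λ w → P (z ∷ w)) (+ʷ-identityʳ x) z∈
        ... | true  | z , hz , z∈ = z ⊕ p , ·ω-⊕ z p hz (pivot-ω (qʷ v))
          , subst (λ w → P ((z ⊕ p) ∷ w)) (+ʷ-cancel x v) (closed z∈ glue∈)

    extend : ∃ λ m → P ≐ Ker (c , m)
    extend with transversal?
    ... | yes ((t ∷ u) , tω , t∈) = just (syndrome c u) , extend-glue t u tω t∈
    ... | no ¬t = nothing , extend-axis (maximal axis⊥)
      where
      axis⊥ : ∀ y → P y → ⟨ ω ∷ 0ʷ , y ⟩ ≡ false
      axis⊥ (b ∷ y) y∈ with (b · ω) in eq
      ... | false = cong₂ _xor_ (trans (·-comm ω b) eq) (⟨0,⟩ y)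
      ... | true  = contradiction ((b ∷ y) , eq , y∈) ¬t

Ker-complete : (P : Word n → Set) → Decidable P → EvenSelfDual P → ∃ λ c → P ≐ Ker c
Ker-complete {zero}  P P? esd = tt , λ { [] → (λ _ → refl) , (λ _ → EvenSelfDual.zero∈ esd) }
Ker-complete {suc n} P P? esd =
  let c , red≐ = Ker-complete Red (reduces? P?) reduction-esd
      m , P≐   = extend c (λ x k → proj₂ (red≐ x) k)
  in (c , m) , P≐
  where open Reduction P P? esd

-- The number of even self-dual codes

ker? : (c : Code n) → Decidable (Ker c)
ker? c x = ≡-dec _≟ᵇ_ (syndrome c x) 0ᵇ

codeSet : Code n → SubsetL n
codeSet c = subsetOf (ker? c)

codeSet-≐ : (c : Code n) → (_∈ᶜ codeSet c) ≐ Ker c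
codeSet-≐ c = subsetOf-≐ (ker? c)

codeSet-esd : (c : Code n) → IsEvenSelfDualCode (codeSet c)
codeSet-esd c = EvenSelfDual⇒esd (Ker-esd c) (codeSet c) (codeSet-≐ c)

codeSet-injective : {c d : Code n} → codeSet c ≡ codeSet d → c ≡ d
codeSet-injective {c = c} {d} eq = Ker-injective c d
  (λ x kc → proj₁ (codeSet-≐ d x) (subst (x ∈ᶜ_) eq (proj₂ (codeSet-≐ c x) kc)))
  (λ x kd → proj₁ (codeSet-≐ c x) (subst (x ∈ᶜ_) (sym eq) (proj₂ (codeSet-≐ d x) kd)))

options : ∀ n → List (Maybe (Vec Bool n))
options n = nothing ∷ map just (allVecs bools n)

allCodes : ∀ n → List (Code n)
allCodes zero    = tt ∷ []
allCodes (suc n) = cartesianProduct (allCodes n) (options n)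

∈-allCodes : (c : Code n) → c ∈ allCodes n
∈-allCodes {zero}  tt            = here refl
∈-allCodes {suc n} (c , nothing) = ∈-cartesianProduct⁺ (∈-allCodes c) (here refl)
∈-allCodes {suc n} (c , just s)  =
  ∈-cartesianProduct⁺ (∈-allCodes c) (there (∈-map⁺ just (∈-allVecs ∈-bools s)))

allCodes-unique : ∀ n → Unique (allCodes n)
allCodes-unique zero    = [] ∷ []
allCodes-unique (suc n) = Unique.cartesianProduct⁺ (allCodes-unique n)
  (All.map⁺ (All.universal (λ _ ()) _) ∷ Unique.map⁺ just-injective (allVecs-unique bools-unique n))

length-allCodes : ∀ n → length (allCodes n) ≡ prodTerm n
length-allCodes zero    = refl
length-allCodes (suc n) = trans (length-cartesianProductWith _,_ (allCodes n) (options n))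
  (cong₂ _*_ (length-allCodes n)
    (trans (cong suc (trans (length-map just (allVecs bools n)) (length-allVecs bools n))) (+-comm 1 (2 ^ n))))

Mₑ≡prodTerm : ∀ n → Mₑ n ≡ prodTerm n
Mₑ≡prodTerm n = trans
  (unique-same-length (Unique.filter⁺ isEvenSelfDualCode? (allSubsets-unique n))
    (Unique.map⁺ codeSet-injective (allCodes-unique n)) to from)
  (trans (length-map codeSet (allCodes n)) (length-allCodes n))
  where
  to : ∀ {C} → C ∈ evenSelfDualCodes n → C ∈ map codeSet (allCodes n)
  to {C} C∈ =
    let c , C≐ = Ker-complete (_∈ᶜ C) (λ x → ∈ᶜ? x C)
          (esd⇒EvenSelfDual C (proj₂ (∈-filter⁻ isEvenSelfDualCode? {xs = allSubsets n} C∈)))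
        C≡ = subset-ext (λ x → proj₂ (codeSet-≐ c x) ∘ proj₁ (C≐ x) , proj₂ (C≐ x) ∘ proj₁ (codeSet-≐ c x))
    in subst (_∈ map codeSet (allCodes n)) (sym C≡) (∈-map⁺ codeSet (∈-allCodes c))
  from : ∀ {C} → C ∈ map codeSet (allCodes n) → C ∈ evenSelfDualCodes n
  from C∈ with c , _ , refl ← ∈-map⁻ codeSet C∈ =
    ∈-filter⁺ isEvenSelfDualCode? (∈-allSubsets (codeSet c)) (codeSet-esd c)

-- Permutations of the coordinates

-- A permutation is its first value a together with a permutation of the n remaining values,
-- renumbered around a; this gives the recursion of the factorial.
consPerm : Fin (suc n) → Vec (Fin n) n → Vec (Fin (suc n)) (suc n)
consPerm a τ = a ∷ Vec.map (punchIn a) τ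

permTables : ∀ n → List (Vec (Fin n) n)
permTables zero    = [] ∷ []
permTables (suc n) = cartesianProductWith consPerm (allFin (suc n)) (permTables n)

consPerm-injective : {a b : Fin (suc n)} {τ υ : Vec (Fin n) n} → consPerm a τ ≡ consPerm b υ → a ≡ b × τ ≡ υ
consPerm-injective {a = a} {τ = τ} {υ} eq with refl , eq′ ← ∷-injective eq =
  refl , lookup-ext λ i → punchIn-injective a _ _
    (trans (sym (lookup-map i (punchIn a) τ)) (trans (cong (λ v → lookup v i) eq′) (lookup-map i (punchIn a) υ)))

permTables-unique : ∀ n → Unique (permTables n)
permTables-unique zero    = [] ∷ []
permTables-unique (suc n) =
  Unique.cartesianProductWith⁺ consPerm consPerm-injective (Unique.allFin⁺ (suc n)) (permTables-unique n)

length-permTables : ∀ n → length (permTables n) ≡ n !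
length-permTables zero    = refl
length-permTables (suc n) = trans (length-cartesianProductWith consPerm (allFin (suc n)) (permTables n))
  (cong₂ _*_ (length-tabulate {n = suc n} (λ i → i)) (length-permTables n))

consPerm-perm : (a : Fin (suc n)) (τ : Vec (Fin n) n) → IsPerm τ → IsPerm (consPerm a τ)
consPerm-perm a τ p fz     fz     _  = refl
consPerm-perm a τ p fz     (fs j) eq = contradiction (sym (trans eq (lookup-map j (punchIn a) τ))) (punchInᵢ≢i a _)
consPerm-perm a τ p (fs i) fz     eq = contradiction (trans (sym (lookup-map i (punchIn a) τ)) eq) (punchInᵢ≢i a _)
consPerm-perm a τ p (fs i) (fs j) eq = cong fs (p i j (punchIn-injective a _ _
  (trans (sym (lookup-map i (punchIn a) τ)) (trans eq (lookup-map j (punchIn a) τ)))))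

permTables-sound : ∀ n {σ} → σ ∈ permTables n → IsPerm σ
permTables-sound zero    _  ()
permTables-sound (suc n) σ∈
  with a , τ , _ , τ∈ , refl ← ∈-cartesianProductWith⁻ consPerm (allFin (suc n)) (permTables n) σ∈
  = consPerm-perm a τ (permTables-sound n τ∈)

permTables-complete : ∀ n (σ : Vec (Fin n) n) → IsPerm σ → σ ∈ permTables n
permTables-complete zero    []      _ = here refl
permTables-complete (suc n) (a ∷ σ) p = subst (_∈ permTables (suc n)) (cong (a ∷_) (lookup-ext eq))
  (∈-cartesianProductWith⁺ consPerm (∈-allFin a) (permTables-complete n τ τ-perm))
  where
  a≢ : ∀ i → a ≢ lookup σ i
  a≢ i eq with () ← p fz (fs i) eq
  τ = tabulate (λ i → punchOut (a≢ i))
  τ-perm : IsPerm τ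
  τ-perm i j eq = suc-injective (p (fs i) (fs j) (punchOut-injective (a≢ i) (a≢ j)
    (trans (sym (lookup∘tabulate _ i)) (trans eq (lookup∘tabulate _ j)))))
  eq : ∀ i → lookup (Vec.map (punchIn a) τ) i ≡ lookup σ i
  eq i = trans (lookup-map i (punchIn a) τ)
    (trans (cong (punchIn a) (lookup∘tabulate _ i)) (punchIn-punchOut (a≢ i)))

length-perms : ∀ n → length (filter isPerm? (allVecs (allFin n) n)) ≡ n !
length-perms n = trans
  (unique-same-length (Unique.filter⁺ isPerm? (allVecs-unique (Unique.allFin⁺ n) n)) (permTables-unique n)
    (λ {σ} σ∈ → permTables-complete n σ (proj₂ (∈-filter⁻ isPerm? {xs = allVecs (allFin n) n} σ∈)))
    (λ {σ} σ∈ → ∈-filter⁺ isPerm? (∈-allVecs ∈-allFin σ) (permTables-sound n σ∈)))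
  (length-permTables n)

-- Pigeonhole: if j were missed, removing it from the target would embed n + 1 points into n.
injective⇒surjective : (f : Fin n → Fin n) → (∀ i j → f i ≡ f j → i ≡ j) → ∀ j → ∃ λ i → f i ≡ j
injective⇒surjective {suc n} f inj j with any? (λ i → f i ≟ᶠ j)
... | yes hit = hit
... | no miss = contradiction
  (injective⇒≤ {f = λ i → punchOut (j≢ i)} (λ {i} {k} eq → inj i k (punchOut-injective (j≢ i) (j≢ k) eq)))
  1+n≰n
  where
  j≢ : ∀ i → j ≢ f i
  j≢ i eq = miss (i , sym eq)

-- The group G and its action

group-as-product : ∀ n → allG n ≡ cartesianProductWith _,_ (filter isPerm? (allVecs (allFin n) n)) (allVecs bools n)
group-as-product n = concatMap-map _,_ (filter isPerm? (allVecs (allFin n) n)) (allVecs bools n)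

allG-unique : ∀ n → Unique (allG n)
allG-unique n = subst Unique (sym (group-as-product n))
  (Unique.cartesianProduct⁺ (Unique.filter⁺ isPerm? (allVecs-unique (Unique.allFin⁺ n) n))
                            (allVecs-unique bools-unique n))

∈-allG : (g : GElt n) → IsG g → g ∈ allG n
∈-allG {n} g@(σ , b) p = subst (g ∈_) (sym (group-as-product n))
  (∈-cartesianProductWith⁺ _,_ (∈-filter⁺ isPerm? (∈-allVecs ∈-allFin σ) p) (∈-allVecs ∈-bools b))

allG-IsG : {g : GElt n} → g ∈ allG n → IsG g
allG-IsG {n} {g} g∈
  with σ , b , σ∈ , _ , refl ← ∈-cartesianProductWith⁻ _,_ (filter isPerm? (allVecs (allFin n) n)) (allVecs bools n)
         (subst (g ∈_) (group-as-product n) g∈)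
  = proj₂ (∈-filter⁻ isPerm? {xs = allVecs (allFin n) n} σ∈)

length-allG : ∀ n → length (allG n) ≡ 2 ^ n * n !
length-allG n = trans (cong length (group-as-product n))
  (trans (length-cartesianProductWith _,_ (filter isPerm? (allVecs (allFin n) n)) (allVecs bools n))
  (trans (cong₂ _*_ (length-perms n) (length-allVecs bools n)) (*-comm (n !) (2 ^ n))))

idᵍ : GElt n
idᵍ = tabulate (λ i → i) , replicate _ false

-- Coordinate i of g x is read from coordinate σ i of x, so tables compose in the order opposite to
-- the actions, and the inner flip is taken at σ i.
comp : GElt n → GElt n → GElt n
comp (σ , b) (σ′ , b′) =
  tabulate (λ i → lookup σ′ (lookup σ i)) , tabulate (λ i → lookup b i xor lookup b′ (lookup σ i))

inverse : (g : GElt n) → IsG g → GElt n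
inverse (σ , b) p = tabulate τ , tabulate (λ i → lookup b (τ i))
  where
  τ : Fin _ → Fin _
  τ j = proj₁ (injective⇒surjective (lookup σ) p j)

lookup-act : (g : GElt n) (x : Word n) (i : Fin n) →
  lookup (act g x) i ≡ flip (lookup (proj₂ g) i) (lookup x (lookup (proj₁ g) i))
lookup-act g x i = lookup∘tabulate _ i

flip-flip : ∀ b c a → flip b (flip c a) ≡ flip (b xor c) a
flip-flip = from-yes (allB? λ b → allB? λ c → allL? λ a → flip b (flip c a) ≟ᴸ flip (b xor c) a)

flip-⊕ : ∀ b a c → flip b (a ⊕ c) ≡ flip b a ⊕ flip b c
flip-⊕ = from-yes (allB? λ b → allL? λ a → allL? λ c → flip b (a ⊕ c) ≟ᴸ (flip b a ⊕ flip b c))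

flip-𝟘 : ∀ b → flip b 𝟘 ≡ 𝟘
flip-𝟘 false = refl
flip-𝟘 true  = refl

norm-flip : ∀ b a → norm (flip b a) ≡ norm a
norm-flip false a = refl
norm-flip true  𝟘 = refl
norm-flip true  𝟙 = refl
norm-flip true  ω = refl
norm-flip true  ω̄ = refl

act-comp : (h g : GElt n) (x : Word n) → act (comp h g) x ≡ act h (act g x)
act-comp h@(σ , b) g@(σ′ , b′) x = lookup-ext λ i → begin
  lookup (act (comp h g) x) i
    ≡⟨ lookup-act (comp h g) x i ⟩
  flip (lookup (proj₂ (comp h g)) i) (lookup x (lookup (proj₁ (comp h g)) i))
    ≡⟨ cong₂ flip (lookup∘tabulate _ i) (cong (lookup x) (lookup∘tabulate _ i)) ⟩
  flip (lookup b i xor lookup b′ (lookup σ i)) (lookup x (lookup σ′ (lookup σ i)))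
    ≡⟨ sym (flip-flip (lookup b i) (lookup b′ (lookup σ i)) _) ⟩
  flip (lookup b i) (flip (lookup b′ (lookup σ i)) (lookup x (lookup σ′ (lookup σ i))))
    ≡⟨ cong (flip (lookup b i)) (sym (lookup-act g x (lookup σ i))) ⟩
  flip (lookup b i) (lookup (act g x) (lookup σ i))
    ≡⟨ sym (lookup-act h (act g x) i) ⟩
  lookup (act h (act g x)) i ∎
  where open ≡-Reasoning

idᵍ-IsG : IsG (idᵍ {n})
idᵍ-IsG i j eq = trans (sym (lookup∘tabulate _ i)) (trans eq (lookup∘tabulate _ j))

act-id : (x : Word n) → act idᵍ x ≡ x
act-id x = lookup-ext λ i → trans (lookup-act idᵍ x i)
  (cong₂ flip (lookup-replicate i false) (cong (lookup x) (lookup∘tabulate _ i)))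

comp-IsG : (h g : GElt n) → IsG h → IsG g → IsG (comp h g)
comp-IsG h g ph pg i j eq = ph i j (pg _ _ (trans (sym (lookup∘tabulate _ i)) (trans eq (lookup∘tabulate _ j))))

module _ (g : GElt n) (p : IsG g) where

  private
    σ = proj₁ g
    b = proj₂ g
    σ⁻¹ = proj₁ (inverse g p)
    b⁻¹ = proj₂ (inverse g p)
    surj = injective⇒surjective (lookup σ) p

  σσ⁻¹ : ∀ i → lookup σ (lookup σ⁻¹ i) ≡ i
  σσ⁻¹ i = trans (cong (lookup σ) (lookup∘tabulate _ i)) (proj₂ (surj i))

  σ⁻¹σ : ∀ i → lookup σ⁻¹ (lookup σ i) ≡ i
  σ⁻¹σ i = p _ _ (σσ⁻¹ (lookup σ i))

  b⁻¹σ : ∀ i → lookup b⁻¹ (lookup σ i) ≡ lookup b i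
  b⁻¹σ i = trans (lookup∘tabulate _ (lookup σ i))
    (cong (lookup b) (trans (sym (lookup∘tabulate _ (lookup σ i))) (σ⁻¹σ i)))

  inverse-IsG : IsG (inverse g p)
  inverse-IsG i j eq = trans (sym (σσ⁻¹ i)) (trans (cong (lookup σ) eq) (σσ⁻¹ j))

  -- The trailing k lets one law do two jobs: k = `idᵍ` gives the right inverse of the action, and a
  -- general k cancels left multiplication in the bijection between transporters and automorphisms.
  comp-inverse-comp : ∀ k → comp g (comp (inverse g p) k) ≡ k
  comp-inverse-comp (σₖ , bₖ) = cong₂ _,_
    (lookup-ext λ i → trans (lookup∘tabulate _ i)
      (trans (lookup∘tabulate _ (lookup σ i)) (cong (lookup σₖ) (σ⁻¹σ i))))
    (lookup-ext λ i → begin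
      lookup (proj₂ (comp g (comp (inverse g p) (σₖ , bₖ)))) i
        ≡⟨ lookup∘tabulate _ i ⟩
      lookup b i xor lookup (proj₂ (comp (inverse g p) (σₖ , bₖ))) (lookup σ i)
        ≡⟨ cong (lookup b i xor_) (lookup∘tabulate _ (lookup σ i)) ⟩
      lookup b i xor (lookup b⁻¹ (lookup σ i) xor lookup bₖ (lookup σ⁻¹ (lookup σ i)))
        ≡⟨ cong₂ (λ c j → lookup b i xor (c xor lookup bₖ j)) (b⁻¹σ i) (σ⁻¹σ i) ⟩
      lookup b i xor (lookup b i xor lookup bₖ i)
        ≡⟨ sym (xor-assoc (lookup b i) _ _) ⟩
      (lookup b i xor lookup b i) xor lookup bₖ i
        ≡⟨ cong (_xor lookup bₖ i) (xor-same (lookup b i)) ⟩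
      lookup bₖ i ∎)
    where open ≡-Reasoning

  act-inverseʳ : ∀ x → act g (act (inverse g p) x) ≡ x
  act-inverseʳ x = begin
    act g (act (inverse g p) x)              ≡⟨ cong (act g ∘ act (inverse g p)) (sym (act-id x)) ⟩
    act g (act (inverse g p) (act idᵍ x))    ≡⟨ cong (act g) (sym (act-comp (inverse g p) idᵍ x)) ⟩
    act g (act (comp (inverse g p) idᵍ) x)   ≡⟨ sym (act-comp g (comp (inverse g p) idᵍ) x) ⟩
    act (comp g (comp (inverse g p) idᵍ)) x  ≡⟨ cong (λ k → act k x) (comp-inverse-comp idᵍ) ⟩
    act idᵍ x                                ≡⟨ act-id x ⟩
    x                                        ∎
    where open ≡-Reasoning

  act-injective : ∀ x y → act g x ≡ act g y → x ≡ y
  act-injective x y eq = lookup-ext λ i → subst (λ j → lookup x j ≡ lookup y j) (σσ⁻¹ i)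
    (flip-injective (lookup b (lookup σ⁻¹ i))
      (trans (sym (lookup-act g x (lookup σ⁻¹ i)))
             (trans (cong (λ w → lookup w (lookup σ⁻¹ i)) eq) (lookup-act g y (lookup σ⁻¹ i)))))
    where
    flip-injective : ∀ b {a c} → flip b a ≡ flip b c → a ≡ c
    flip-injective b {a} {c} eq = trans (sym (involutive b a)) (trans (cong (flip b) eq) (involutive b c))
      where
      involutive : ∀ b a → flip b (flip b a) ≡ a
      involutive = from-yes (allB? λ b → allL? λ a → flip b (flip b a) ≟ᴸ a)

  act-inverseˡ : ∀ x → act (inverse g p) (act g x) ≡ x
  act-inverseˡ x = act-injective _ _ (act-inverseʳ (act g x))

  ewt-act : ∀ x → ewt (act g x) ≡ ewt x
  ewt-act x = begin
    ewt (act g x)                           ≡⟨ ewt-∑ (act g x) ⟩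
    ∑ (λ i → norm (lookup (act g x) i))     ≡⟨ sum-cong-≗ (λ i → trans (cong norm (lookup-act g x i)) (norm-flip (lookup b i) _)) ⟩
    ∑ (λ i → norm (lookup x (lookup σ i)))  ≡⟨ sym (sum-permute (norm ∘ lookup x) π) ⟩
    ∑ (norm ∘ lookup x)                     ≡⟨ sym (ewt-∑ x) ⟩
    ewt x                                   ∎
    where
    open ≡-Reasoning
    π : Permutation′ n
    π = permutation (lookup σ) (lookup σ⁻¹) σσ⁻¹ σ⁻¹σ
    ewt-∑ : ∀ {m} (x : Word m) → ewt x ≡ ∑ (norm ∘ lookup x)
    ewt-∑ []      = refl
    ewt-∑ (a ∷ x) = cong (norm a +_) (ewt-∑ x)

act-+ : (g : GElt n) (x y : Word n) → act g (x +ʷ y) ≡ act g x +ʷ act g y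
act-+ g@(σ , b) x y = lookup-ext λ i → begin
  lookup (act g (x +ʷ y)) i
    ≡⟨ lookup-act g (x +ʷ y) i ⟩
  flip (lookup b i) (lookup (x +ʷ y) (lookup σ i))
    ≡⟨ cong (flip (lookup b i)) (lookup-zipWith _⊕_ (lookup σ i) x y) ⟩
  flip (lookup b i) (lookup x (lookup σ i) ⊕ lookup y (lookup σ i))
    ≡⟨ flip-⊕ (lookup b i) _ _ ⟩
  flip (lookup b i) (lookup x (lookup σ i)) ⊕ flip (lookup b i) (lookup y (lookup σ i))
    ≡⟨ sym (cong₂ _⊕_ (lookup-act g x i) (lookup-act g y i)) ⟩
  lookup (act g x) i ⊕ lookup (act g y) i
    ≡⟨ sym (lookup-zipWith _⊕_ i (act g x) (act g y)) ⟩
  lookup (act g x +ʷ act g y) i ∎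
  where open ≡-Reasoning

act-0 : (g : GElt n) → act g 0ʷ ≡ 0ʷ
act-0 g@(σ , b) = lookup-ext λ i → trans (lookup-act g 0ʷ i)
  (trans (cong (flip (lookup b i)) (lookup-replicate (lookup σ i) 𝟘))
         (trans (flip-𝟘 (lookup b i)) (sym (lookup-replicate i 𝟘))))

qʷ-act : (g : GElt n) → IsG g → ∀ x → qʷ (act g x) ≡ qʷ x
qʷ-act g p x = trans (sym (odd-ewt (act g x))) (trans (cong odd (ewt-act g p x)) (odd-ewt x))

-- The scalar product is recovered from `qʷ` by polarisation, and the action is additive and
-- preserves weights.
⟨⟩-act : (g : GElt n) → IsG g → ∀ x y → ⟨ act g x , act g y ⟩ ≡ ⟨ x , y ⟩
⟨⟩-act g p x y = trans (⟨⟩-from-qʷ (act g x) (act g y))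
  (trans (cong₂ _xor_ (trans (cong qʷ (sym (act-+ g x y))) (qʷ-act g p (x +ʷ y)))
                      (cong₂ _xor_ (qʷ-act g p x) (qʷ-act g p y)))
         (sym (⟨⟩-from-qʷ x y)))
  where
  ⟨⟩-from-qʷ : (x y : Word _) → ⟨ x , y ⟩ ≡ qʷ (x +ʷ y) xor (qʷ x xor qʷ y)
  ⟨⟩-from-qʷ x y = trans (sym (xor-cancel ⟨ x , y ⟩ _)) (cong (_xor (qʷ x xor qʷ y)) (sym (qʷ-+ x y)))

-- The action of G on codes

MapsTo-esd : (D C : SubsetL n) (g : GElt n) → IsG g → MapsTo g D C → IsEvenSelfDualCode D → IsEvenSelfDualCode C
MapsTo-esd {n} D C g p m esd = EvenSelfDual⇒esd preimage C C≐
  where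
  open EvenSelfDual (esd⇒EvenSelfDual D esd)
  g⁻¹ = inverse g p
  r = inverse-IsG g p
  -- C is the preimage of D under g⁻¹, and each property of D pulls back along this additive
  -- isometry. For maximality, a test word y of D is transported to g y.
  P : Word n → Set
  P y = act g⁻¹ y ∈ᶜ D
  C≐ : (_∈ᶜ C) ≐ P
  C≐ y = (λ y∈ → proj₂ (m (act g⁻¹ y)) (subst (_∈ᶜ C) (sym (act-inverseʳ g p y)) y∈))
       , (λ y∈ → subst (_∈ᶜ C) (act-inverseʳ g p y) (proj₁ (m (act g⁻¹ y)) y∈))
  preimage : EvenSelfDual P
  preimage = record
    { zero∈      = subst (_∈ᶜ D) (sym (act-0 g⁻¹)) zero∈
    ; closed     = λ {x} {y} x∈ y∈ → subst (_∈ᶜ D) (sym (act-+ g⁻¹ x y)) (closed {act g⁻¹ x} {act g⁻¹ y} x∈ y∈)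
    ; orthogonal = λ {x} {y} x∈ y∈ →
        trans (sym (⟨⟩-act g⁻¹ r x y)) (orthogonal {act g⁻¹ x} {act g⁻¹ y} x∈ y∈)
    ; maximal    = λ {x} x⊥ → maximal {act g⁻¹ x} λ y y∈ → trans
        (trans (sym (⟨⟩-act g p (act g⁻¹ x) y)) (cong ⟨_, act g y ⟩ (act-inverseʳ g p x)))
        (x⊥ (act g y) (subst (_∈ᶜ D) (sym (act-inverseˡ g p y)) y∈))
    ; isotropic  = λ {x} x∈ → trans (sym (qʷ-act g⁻¹ r x)) (isotropic {act g⁻¹ x} x∈)
    }

image : (g : GElt n) → IsG g → (D : SubsetL n) → ∃ λ C → MapsTo g D C
image g p D = subsetOf P? , λ x →
    (λ x∈ → proj₂ (subsetOf-≐ P? (act g x)) (subst (_∈ᶜ D) (sym (act-inverseˡ g p x)) x∈))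
  , (λ gx∈ → subst (_∈ᶜ D) (act-inverseˡ g p x) (proj₁ (subsetOf-≐ P? (act g x)) gx∈))
  where
  P? = λ y → ∈ᶜ? (act (inverse g p) y) D

MapsTo-functional : (D C C′ : SubsetL n) (g : GElt n) → IsG g → MapsTo g D C → MapsTo g D C′ → C ≡ C′
MapsTo-functional D C C′ g p m m′ = subset-ext λ y →
  subst (λ z → (z ∈ᶜ C → z ∈ᶜ C′) × (z ∈ᶜ C′ → z ∈ᶜ C)) (act-inverseʳ g p y)
    ( proj₁ (m′ (act (inverse g p) y)) ∘ proj₂ (m (act (inverse g p) y))
    , proj₁ (m (act (inverse g p) y)) ∘ proj₂ (m′ (act (inverse g p) y)))

MapsTo-id : (D : SubsetL n) → MapsTo idᵍ D D
MapsTo-id D x = subst (_∈ᶜ D) (sym (act-id x)) , subst (_∈ᶜ D) (act-id x)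

MapsTo-comp : (D C B : SubsetL n) (h g : GElt n) → MapsTo g D C → MapsTo h C B → MapsTo (comp h g) D B
MapsTo-comp D C B h g m k x =
    (λ x∈ → subst (_∈ᶜ B) (sym (act-comp h g x)) (proj₁ (k (act g x)) (proj₁ (m x) x∈)))
  , (λ y∈ → proj₂ (m x) (proj₂ (k (act g x)) (subst (_∈ᶜ B) (act-comp h g x) y∈)))

MapsTo-inverse : (D C : SubsetL n) (g : GElt n) (p : IsG g) → MapsTo g D C → MapsTo (inverse g p) C D
MapsTo-inverse D C g p m y =
    (λ y∈ → proj₂ (m (act (inverse g p) y)) (subst (_∈ᶜ C) (sym (act-inverseʳ g p y)) y∈))
  , (λ x∈ → subst (_∈ᶜ C) (act-inverseʳ g p y) (proj₁ (m (act (inverse g p) y)) x∈))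

Equivalent-join : (D D′ C : SubsetL n) → Equivalent D C → Equivalent D′ C → Equivalent D D′
Equivalent-join D D′ C (g , pg , m) (h , ph , k) =
  comp (inverse h ph) g , comp-IsG (inverse h ph) g (inverse-IsG h ph) pg ,
  MapsTo-comp D C D′ (inverse h ph) g m (MapsTo-inverse D′ C h ph k)

equivalent? : (D C : SubsetL n) → Dec (Equivalent D C)
equivalent? {n} D C = map′
  (λ a → let g , g∈ , m = find a in g , allG-IsG g∈ , m)
  (λ (g , p , m) → lose (∈-allG g p) m)
  (Any.any? (λ g → mapsTo? g D C) (allG n))

-- Orbit counting

transporters : SubsetL n → SubsetL n → List (GElt n)
transporters {n} D C = filter (λ g → mapsTo? g D C) (allG n)

∈-transporters : (D C : SubsetL n) (g : GElt n) → IsG g → MapsTo g D C → g ∈ transporters D C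
∈-transporters D C g p m = ∈-filter⁺ (λ g → mapsTo? g D C) (∈-allG g p) m

transporters-sound : (D C : SubsetL n) {g : GElt n} → g ∈ transporters D C → IsG g × MapsTo g D C
transporters-sound {n} D C g∈ =
  let g∈G , m = ∈-filter⁻ (λ g → mapsTo? g D C) {xs = allG n} g∈ in allG-IsG g∈G , m

transporters-unique : (D C : SubsetL n) → Unique (transporters D C)
transporters-unique {n} D C = Unique.filter⁺ (λ g → mapsTo? g D C) (allG-unique n)

-- If h D = C then h⁻¹ ∘_ is a bijection from the transporters of D to C onto Aut D.
length-transporters : (D C : SubsetL n) → Equivalent D C → length (transporters D C) ≡ autOrder D
length-transporters D C (h , p , m) = trans (sym (length-map (comp h⁻¹) (transporters D C)))
  (unique-same-length (Unique.map⁺ injective (transporters-unique D C)) (transporters-unique D D) to from)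
  where
  h⁻¹ = inverse h p
  r   = inverse-IsG h p
  h⁻¹⁻¹ = inverse h⁻¹ r
  m⁻¹ : MapsTo h⁻¹ C D
  m⁻¹ = MapsTo-inverse D C h p m

  injective : ∀ {g k} → comp h⁻¹ g ≡ comp h⁻¹ k → g ≡ k
  injective {g} {k} eq = trans (sym (comp-inverse-comp h p g)) (trans (cong (comp h) eq) (comp-inverse-comp h p k))

  to : ∀ {g} → g ∈ map (comp h⁻¹) (transporters D C) → g ∈ transporters D D
  to g∈ with k , k∈ , refl ← ∈-map⁻ (comp h⁻¹) g∈ =
    let q , mk = transporters-sound D C k∈
    in ∈-transporters D D (comp h⁻¹ k) (comp-IsG h⁻¹ k r q) (MapsTo-comp D C D h⁻¹ k mk m⁻¹)

  from : ∀ {g} → g ∈ transporters D D → g ∈ map (comp h⁻¹) (transporters D C)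
  from {g} g∈ = let q , mg = transporters-sound D D g∈ in
    subst (_∈ map (comp h⁻¹) (transporters D C)) (comp-inverse-comp h⁻¹ r g)
      (∈-map⁺ (comp h⁻¹) (∈-transporters D C (comp h⁻¹⁻¹ g) (comp-IsG h⁻¹⁻¹ g (inverse-IsG h⁻¹ r) q)
        (MapsTo-comp D D C h⁻¹⁻¹ g mg (MapsTo-inverse C D h⁻¹ r m⁻¹))))

evenSelfDualCodes-sound : (C : SubsetL n) → C ∈ evenSelfDualCodes n → IsEvenSelfDualCode C
evenSelfDualCodes-sound {n} C C∈ = proj₂ (∈-filter⁻ isEvenSelfDualCode? {xs = allSubsets n} C∈)

orbit : SubsetL n → List (SubsetL n)
orbit {n} D = filter (equivalent? D) (evenSelfDualCodes n)

-- Partition G by the code g D, which is again even and self-dual. The part over C has |Aut D|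
-- elements if C is in the orbit of D and is empty otherwise.
orbit-stabiliser : (D : SubsetL n) → IsEvenSelfDualCode D → 2 ^ n * n ! ≡ autOrder D * length (orbit D)
orbit-stabiliser {n} D esd = begin
  2 ^ n * n !
    ≡⟨ sym (length-allG n) ⟩
  length (allG n)
    ≡⟨ length-fibres (λ g C → mapsTo? g D C) (allG n) (evenSelfDualCodes n) cover disjoint ⟩
  sum (map (λ C → length (transporters D C)) (evenSelfDualCodes n))
    ≡⟨ sum-filter (equivalent? D) _ (autOrder D) (length-transporters D) no-transporters (evenSelfDualCodes n) ⟩
  autOrder D * length (orbit D) ∎
  where
  open ≡-Reasoning
  cover : ∀ {g} → g ∈ allG n → Any (MapsTo g D) (evenSelfDualCodes n)
  cover {g} g∈ = let C , m = image g (allG-IsG g∈) D in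
    lose (∈-filter⁺ isEvenSelfDualCode? (∈-allSubsets C) (MapsTo-esd D C g (allG-IsG g∈) m esd)) m
  disjoint : AllPairs (λ C C′ → ∀ g → g ∈ allG n → MapsTo g D C → ¬ MapsTo g D C′) (evenSelfDualCodes n)
  disjoint = AllPairs.map (λ {C} {C′} C≢C′ g g∈ m m′ → C≢C′ (MapsTo-functional D C C′ g (allG-IsG g∈) m m′))
    (Unique.filter⁺ isEvenSelfDualCode? (allSubsets-unique n))
  no-transporters : ∀ C → ¬ Equivalent D C → length (transporters D C) ≡ 0
  no-transporters C ¬eq with transporters D C in eq
  ... | []    = refl
  ... | g ∷ _ = contradiction (g , transporters-sound D C (subst (g ∈_) (sym eq) (here refl))) ¬eq

-- The identity is an automorphism; hence `÷` never takes its default value 0 in the mass formula.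
autOrder≢0 : (D : SubsetL n) → autOrder D ≢ 0
autOrder≢0 D eq = nonempty (transporters D D) eq (∈-transporters D D idᵍ idᵍ-IsG (MapsTo-id D))
  where
  nonempty : (gs : List (GElt _)) → length gs ≡ 0 → ¬ (idᵍ ∈ gs)
  nonempty [] _ ()

÷-cancelˡ : ∀ {m} a k → a ≢ 0 → m ≡ a * k → m ÷ a ≡ k
÷-cancelˡ zero    k a≢0 _    = contradiction refl a≢0
÷-cancelˡ (suc a) k _   refl = trans (cong (_÷ suc a) (*-comm (suc a) k)) (m*n/n≡m k (suc a))

-- Each code lies in the orbit of exactly one representative D, and that orbit has 2ⁿ n! / |Aut D|
-- elements, the division being exact by `orbit-stabiliser`.
mass-formula : (reps : List (SubsetL n)) →
  All IsEvenSelfDualCode reps →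
  AllPairs (λ C D → ¬ Equivalent C D) reps →
  (∀ C → IsEvenSelfDualCode C → Any (λ D → Equivalent D C) reps) →
  Mₑ n ≡ sum (map (λ C → (2 ^ n * n !) ÷ autOrder C) reps)
mass-formula {n} reps esds inequivalent complete = trans
  (length-fibres (λ C D → equivalent? D C) (evenSelfDualCodes n) reps
    (λ {C} C∈ → complete C (evenSelfDualCodes-sound C C∈))
    (AllPairs.map (λ {D} {D′} ¬eq C _ e e′ → ¬eq (Equivalent-join D D′ C e e′)) inequivalent))
  (cong sum (map-cong-local (All.map
    (λ {D} esd → sym (÷-cancelˡ (autOrder D) _ (autOrder≢0 D) (orbit-stabiliser D esd))) esds)))

theorem4p10 : (n : ℕ) → 1 ≤ n →
    (reps : List (SubsetL n)) →
    All IsEvenSelfDualCode reps →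
    AllPairs (λ C D → ¬ Equivalent C D) reps →
    (∀ (C : SubsetL n) → IsEvenSelfDualCode C → Any (λ D → Equivalent D C) reps) →
    (Mₑ n ≡ sum (map (λ C → (2 ^ n * n !) ÷ autOrder C) reps))
    × (Mₑ n ≡ prodTerm n)
theorem4p10 n _ reps esds inequivalent complete =
  mass-formula reps esds inequivalent complete , Mₑ≡prodTerm n
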